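{- Let $n\ge 6$ be an even integer, let $c$ be an integer with $1<c<n/2$, let $S=\{\pm 1,\pm c,n/2\}\subseteq\mathbb{Z}_n$, and assume that $\Gamma=\mathrm{Cay}(\mathbb{Z}_n;S)$ is closed distance magic. Assume that there exists $j\in\mathcal{J}_n(S)$ of type $2$, that $c$ is odd, and that all $j\in\mathcal{J}_n(S)$ are of type $2$ or $3^-$. Then $\Gamma$ is isomorphic to a graph $\mathrm{Cay}(\mathbb{Z}_n;\{\pm1,\pm c',n/2\})$ with $1<c'<n/2$ such that $n=3\cdot 2^t(6k-(-1)^t)$ and $c'=2^{t-1}(6k-(-1)^t)+1$ for some integer $t\ge 2$ and some integer $k\ge 0$ such that $c'\ge 2$.
   Context: $\mathrm{Cay}(\mathbb{Z}_n;S)$ is the graph with vertex set $\mathbb{Z}_n$ in which $g,h$ are adjacent iff $h-g\in S$. A graph $\Gamma=(V,E)$ of order $n$ is closed distance magic if there are a bijection $\ell:V\to\{1,\ldots,n\}$ and a positive integer $r$ such that for all $u\in V$ the sum of the labels of $u$ and all its neighbors equals $r$. For $0\le j\le n-1$ let $\chi_j(x)=\cos(2\pi xj/n)+\mathbf{i}\sin(2\pi xj/n)$ and $\chi_j(S)=\sum_{x\in S}\chi_j(x)$; $\mathcal{J}_n(S)$ is the set of $j\in\{0,\ldots,n-1\}$ with $\chi_j(S)=-1$. An even $j\in\mathcal{J}_n(S)$ is of type $2$ if $\{\frac{2\pi j}{n},\frac{2\pi jc}{n}\}=\{\pm\frac{2\pi}{3}+2k_1\pi,\pm\frac{2\pi}{3}+2k_2\pi\}$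 for some $k_1,k_2\in\mathbb{Z}$ and some (independent) choice of signs. An odd $j\in\mathcal{J}_n(S)$ is of type $3^-$ if $j=\frac{n(2k+1)}{2(c-1)}$ for some $k\in\mathbb{Z}$. -}

module Defs where

open import Algebra.Apartness.Bundles using (HeytingField; HeytingCommutativeRing)
open import Algebra.Bundles using (CommutativeRing)
open import Algebra.Morphism.Structures using (module RingMorphisms)
open import Data.Fin.Base using (Fin; toℕ; fromℕ<)
import Data.Fin.Properties as Fin
open import Data.Fin.Subset using (Subset; _∈_; _∪_; ⁅_⁆)
open import Data.Fin.Subset.Properties using (_∈?_)
open import Data.Integer.Base as ℤ using (ℤ; +_)
open import Data.Integer.DivMod using (n%ℕd<d)
open import Data.List.Base using (allFin; filter; foldr; map)
open import Data.Nat.Base as ℕ using (ℕ; suc; NonZero)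
open import Data.Nat.Divisibility using (_∣_)
open import Data.Nat.ListAction using (sum)
open import Data.Product.Base using (Σ-syntax; ∃-syntax; _×_; _,_)
open import Data.Rational.Base as ℚ using (ℚ)
open import Data.Sign.Base as Sign using (Sign)
open import Data.Sum.Base using (_⊎_)
open import Function.Bundles using (_⤖_; _⇔_; module Bijection)
open import Level using (0ℓ) renaming (suc to lsuc)
open import Relation.Binary.Core using (Rel)
open import Relation.Binary.Definitions using (Decidable)
open import Relation.Binary.PropositionalEquality.Core using (_≡_)
open import Relation.Binary.Structures using (IsStrictPartialOrder)
open import Relation.Nullary.Decidable using (_⊎-dec_)
open import Relation.Nullary.Negation using (¬_)
open import Relation.Unary using (Pred; _≐_)

------------------------------------------------------------------------
-- Real numbers

-- The library has no real numbers.  They are axiomatised here as a Cauchy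
-- complete Archimedean ordered field, which determines them up to unique
-- isomorphism.  The axioms are phrased constructively (apartness and strict
-- order), so that they hold for the usual constructive reals as well as for
-- the classical ones.
record RealNumbers : Set (lsuc 0ℓ) where
  infix 4 _<_
  field
    heytingField : HeytingField 0ℓ 0ℓ 0ℓ

  open HeytingField heytingField public

  commutativeRing : CommutativeRing 0ℓ 0ℓ
  commutativeRing =
    HeytingCommutativeRing.commutativeRing heytingCommutativeRing

  field
    _<_                  : Rel Carrier 0ℓ
    isStrictPartialOrder : IsStrictPartialOrder _≈_ _<_
    #⇔<>                 : ∀ x y → (x # y) ⇔ ((x < y) ⊎ (y < x))
    +-monoˡ-<            : ∀ x y z → x < y → (x + z) < (y + z)
    *-pos                : ∀ x y → 0# < x → 0# < y → 0# < (x * y)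

  -- The embedding of ℚ is uniquely determined by the field structure; it is
  -- a field of the record only so that rational multiples such as 2πxj/n can
  -- be written without carrying proofs of invertibility.
  open RingMorphisms ℚ.+-*-rawRing (CommutativeRing.rawRing commutativeRing)
    using (IsRingHomomorphism)

  field
    fromℚ                    : ℚ → Carrier
    fromℚ-isRingHomomorphism : IsRingHomomorphism fromℚ
    archimedean              : ∀ x → ∃[ m ] (x < fromℚ (+ m ℚ./ 1))

  IsCauchy : (ℕ → Carrier) → Set
  IsCauchy s = ∀ ε → 0# < ε →
    ∃[ N ] (∀ k m → N ℕ.≤ k → N ℕ.≤ m → (s k - s m) < ε)

  _⟶_ : (ℕ → Carrier) → Carrier → Set
  s ⟶ x = ∀ ε → 0# < ε →
    ∃[ N ] (∀ k → N ℕ.≤ k → ((s k - x) < ε) × ((x - s k) < ε))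

  field
    complete : ∀ s → IsCauchy s → ∃[ x ] (s ⟶ x)

-- The classical axioms for sine, cosine and π.  They determine all three
-- uniquely: the inequalities on (0, π/2) force sin x / x → 1 as x → 0, so that
-- angles are measured in radians.
record Trigonometry (ℝ : RealNumbers) : Set where
  open RealNumbers ℝ
  field
    π       : Carrier
    cos sin : Carrier → Carrier

  π/2 : Carrier
  π/2 = fromℚ (+ 1 ℚ./ 2) * π

  field
    0<π      : 0# < π
    cos-cong : ∀ {x y} → x ≈ y → cos x ≈ cos y
    sin-cong : ∀ {x y} → x ≈ y → sin x ≈ sin y
    cos-0    : cos 0# ≈ 1#
    sin-π/2  : sin π/2 ≈ 1#
    cos-π    : cos π ≈ - 1#
    cos-sub  : ∀ x y → cos (y - x) ≈ (cos y * cos x) + (sin y * sin x)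
    -- 0 < cos x < sin x / x < 1 / cos x, with denominators cleared
    0<cos    : ∀ x → 0# < x → x < π/2 → 0# < cos x
    xcos<sin : ∀ x → 0# < x → x < π/2 → (x * cos x) < sin x
    sincos<x : ∀ x → 0# < x → x < π/2 → (sin x * cos x) < x

------------------------------------------------------------------------
-- Graphs

-- Only applied below to connection sets closed under negation and not
-- containing 0, for which the adjacency relation is symmetric and irreflexive.
record Graph (n : ℕ) : Set₁ where
  field
    Adj  : Rel (Fin n) 0ℓ
    adj? : Decidable Adj

_≅_ : ∀ {n} → Graph n → Graph n → Set
_≅_ {n} G H = Σ[ φ ∈ Fin n ⤖ Fin n ]
  (∀ u v → Graph.Adj G u v ⇔ Graph.Adj H (Bijection.to φ u) (Bijection.to φ v))

-- A bijection V → {1,…,n} is given by a bijection ℓ onto Fin n; the label of v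
-- is then 1 + ℓ(v).
label : ∀ {n} → Fin n ⤖ Fin n → Fin n → ℕ
label ℓ v = suc (toℕ (Bijection.to ℓ v))

closedNeighbourhoodSum : ∀ {n} → Graph n → (Fin n → ℕ) → Fin n → ℕ
closedNeighbourhoodSum {n} G f u =
  sum (map f (filter (λ v → (v Fin.≟ u) ⊎-dec (Graph.adj? G u v)) (allFin n)))

ClosedDistanceMagic : ∀ {n} → Graph n → Set
ClosedDistanceMagic {n} G = Σ[ ℓ ∈ Fin n ⤖ Fin n ] Σ[ r ∈ ℕ ]
  (0 ℕ.< r) × (∀ u → closedNeighbourhoodSum G (label ℓ) u ≡ r)

------------------------------------------------------------------------
-- Circulant graphs; ℤₙ is Fin n

residue : ∀ n .{{_ : NonZero n}} → ℤ → Fin n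
residue n z = fromℕ< (n%ℕd<d z n)

Cay : ∀ n .{{_ : NonZero n}} → Subset n → Graph n
Cay n S = record
  { Adj  = λ g h → residue n (+ toℕ h ℤ.- + toℕ g) ∈ S
  ; adj? = λ g h → residue n (+ toℕ h ℤ.- + toℕ g) ∈? S
  }

connectionSet : ∀ n .{{_ : NonZero n}} → ℕ → Subset n
connectionSet n c =
    ⁅ residue n (+ 1) ⁆ ∪ ⁅ residue n (ℤ.- (+ 1)) ⁆
  ∪ ⁅ residue n (+ c) ⁆ ∪ ⁅ residue n (ℤ.- (+ c)) ⁆
  ∪ ⁅ residue n (+ (n ℕ./ 2)) ⁆

------------------------------------------------------------------------
-- Characters

module _ (ℝ : RealNumbers) (trig : Trigonometry ℝ) where
  open RealNumbers ℝ
  open Trigonometry trig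

  -- A complex number is the pair of its real and imaginary parts.
  ℂ : Set
  ℂ = Carrier × Carrier

  infix  4 _≈ℂ_
  infixl 6 _+ℂ_

  _≈ℂ_ : Rel ℂ 0ℓ
  (a , b) ≈ℂ (a′ , b′) = (a ≈ a′) × (b ≈ b′)

  _+ℂ_ : ℂ → ℂ → ℂ
  (a , b) +ℂ (a′ , b′) = (a + a′ , b + b′)

  0ℂ -1ℂ : ℂ
  0ℂ  = (0# , 0#)
  -1ℂ = (- 1# , 0#)

  χ : ∀ {n} .{{_ : NonZero n}} → Fin n → Fin n → ℂ
  χ {n} j x = (cos θ , sin θ)
    where
    θ : Carrier
    θ = fromℚ (+ (2 ℕ.* toℕ x ℕ.* toℕ j) ℚ./ n) * π

  χ[_] : ∀ {n} .{{_ : NonZero n}} → Fin n → Subset n → ℂ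
  χ[_] {n} j S = foldr _+ℂ_ 0ℂ (map (χ j) (filter (_∈? S) (allFin n)))

  J : ∀ n .{{_ : NonZero n}} → Subset n → Pred (Fin n) 0ℓ
  J n S j = χ[ j ] S ≈ℂ -1ℂ

  -- The set {a, b} of real numbers.
  pair : Carrier → Carrier → Pred Carrier 0ℓ
  pair a b x = (x ≈ a) ⊎ (x ≈ b)

  signed : Sign → Carrier → Carrier
  signed Sign.+ x = x
  signed Sign.- x = - x

  thirdTurn : Sign → ℤ → Carrier
  thirdTurn s k =
    signed s (fromℚ (+ 2 ℚ./ 3) * π) + (fromℚ ((+ 2 ℤ.* k) ℚ./ 1) * π)

  Type2 : ∀ n .{{_ : NonZero n}} → ℕ → Pred (Fin n) 0ℓ
  Type2 n c j =
    (2 ∣ toℕ j) × J n (connectionSet n c) j ×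
    (∃[ s₁ ] ∃[ s₂ ] ∃[ k₁ ] ∃[ k₂ ]
      (pair (fromℚ (+ (2 ℕ.* toℕ j) ℚ./ n) * π)
            (fromℚ (+ (2 ℕ.* toℕ j ℕ.* c) ℚ./ n) * π)
       ≐ pair (thirdTurn s₁ k₁) (thirdTurn s₂ k₂)))

  -- j = n(2k+1) / (2(c-1)), with the denominator (nonzero since c > 1) cleared
  Type3⁻ : ∀ n .{{_ : NonZero n}} → ℕ → Pred (Fin n) 0ℓ
  Type3⁻ n c j =
    (¬ (2 ∣ toℕ j)) × J n (connectionSet n c) j ×
    (∃[ k ] (+ toℕ j ℤ.* (+ 2 ℤ.* (+ c ℤ.- + 1))
             ≡ + n ℤ.* (+ 2 ℤ.* k ℤ.+ + 1)))

module Submission where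

-- Write w for the labelling. Summing the magic condition against the character
-- χ_j gives (1 + χ_j(S)) ŵ(j) = 0 for j ≠ 0, so ŵ is supported on 𝒥ₙ(S) and 0.
-- If p j ≡ 0 (mod n) for all j ∈ 𝒥ₙ(S), Fourier inversion makes w p-periodic,
-- and since w is injective, n ∣ p.
--
-- Put d = c - 1. Type 2 gives n ∣ 3 j, and type 3⁻ says that 2 d j is an odd
-- multiple of n. Hence p = 6 d is a period, so n = 6 d or n = 3 d. In the latter
-- case parity excludes type 3⁻, and p = 3 would be a period. So n = 6 d, and 3 ∤ d
-- because otherwise p = 2 d would be a period. A type 2 element forces 3 ∤ c = d + 1,
-- whence d ≡ 1 (mod 3), and d is even. Writing d = 2^(t-1) q with q odd gives the
-- required form with c′ = c, and the isomorphism is the identity.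

import Algebra.Apartness.Properties.HeytingCommutativeRing as HeytingProperties
import Algebra.Properties.Ring as RingProperties
import Algebra.Properties.Semiring.Sum as Sum
import Algebra.Solver.Ring as RingSolver
open import Algebra.Bundles using (CommutativeRing)
open import Algebra.Morphism.Structures using (module RingMorphisms)
open import Algebra.Solver.Ring.AlmostCommutativeRing using (fromCommutativeRing; _-Raw-AlmostCommutative⟶_)
open import Data.Bool.Base using (if_then_else_)
open import Data.Empty using (⊥-elim)
open import Data.Fin.Base using (Fin; zero; suc; toℕ; punchIn)
import Data.Fin.Properties as Fin
open import Data.Fin.Permutation using (Permutation′; permutation)
open import Data.Fin.Subset using (_∈_; _∉_; _∪_; ⁅_⁆)
open import Data.Fin.Subset.Properties using (_∈?_; x∈p∪q⁻; x∈p∪q⁺; x∈⁅x⁆; x∈⁅y⁆⇒x≡y)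
open import Data.Integer.Base as ℤ using (ℤ; +_; -[1+_]; +[1+_]; -1ℤ)
open import Data.Integer.DivMod using (a≡a%ℕn+[a/ℕn]*n; n%ℕd<d)
open import Data.Integer.Divisibility.Signed using (divides; ∣⇒∣ᵤ; ∣ᵤ⇒∣; ∣m⇒∣-m; ∣m⇒∣m*n; ∣n⇒∣m*n; ∣m∣n⇒∣m+n; ∣m∣n⇒∣m-n; ∣m+n∣m⇒∣n) renaming (_∣_ to _∣ℤ_; _∣?_ to _∣ℤ?_)
import Data.Integer.Properties as ℤ
open import Data.Integer.Tactic.RingSolver using (solve-∀)
open import Data.List.Base using (foldr; map; filter; tabulate)
open import Data.Maybe.Base using (Maybe; just; nothing)
open import Data.Nat.Base as ℕ using (ℕ; zero; suc; NonZero; s≤s; z≤n)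
import Data.Nat.Divisibility as ℕ
import Data.Nat.DivMod as ℕ
open import Data.Nat.Induction using (<-rec)
import Data.Nat.Properties as ℕ
import Data.Nat.Tactic.RingSolver as ℕ-Solver
open import Data.Product.Base using (_×_; _,_; proj₁; proj₂; ∃-syntax; Σ-syntax)
open import Data.Rational.Base as ℚ using (ℚ; mkℚ; 0ℚ; 1ℚ; toℚᵘ; fromℚᵘ)
import Data.Rational.Properties as ℚ
open import Data.Rational.Unnormalised.Base as ℚᵘ using (mkℚᵘ; *≡*)
import Data.Rational.Unnormalised.Properties as ℚᵘ
open import Data.Sign.Base as Sign using (Sign)
open import Data.Sum.Base using (_⊎_; inj₁; inj₂; [_,_]′)
open import Function.Base using (_∘_; id)
open import Function.Bundles using (module Bijection; module Equivalence)
open import Function.Construct.Identity using (⤖-id; ⇔-id)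
open import Relation.Binary.Definitions using (tri<; tri≈; tri>)
open import Relation.Binary.PropositionalEquality as ≡ using (_≡_; _≢_; cong; cong₂; subst)
open import Relation.Binary.Structures using (module IsStrictPartialOrder)
open import Relation.Nullary.Decidable using (Dec; yes; no; does; _⊎-dec_)
open import Relation.Nullary.Negation using (¬_; contradiction)
open import Relation.Unary using (Pred; Decidable)
open import Defs

-- The axioms for the reals are constructive, so neither equality nor order of reals can be decided.
-- Two facts make up for this. Equations are stable under double negation, because apartness is
-- tight. The angles that must be compared are rational multiples of π, so they can be compared
-- through ℚ. Complex numbers are avoided in the Fourier argument: S = -S makes 1 + χ_j(S) real, and
-- cosines alone suffice. The period 6 d is a common multiple of 3 and 2 d, the factors that carry j
-- of type 2 and of type 3⁻ to multiples of n. From c < n/2 comes 2 d < n, so 6 d < 3 n, and this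
-- leaves only n = 6 d and n = 3 d. The shape of q has this origin: 2^(t-1) q ≡ 1 (mod 3) gives q ≡
-- (-1)^(t-1) (mod 3), and q is odd, so q ≡ -(-1)^t (mod 6). Evenness of d gives t ≥ 2.

-- Arithmetic of fractions in ℚ.

/-cross : ∀ a m b n .{{_ : NonZero m}} .{{_ : NonZero n}} →
          a ℤ.* + n ≡ b ℤ.* + m → a ℚ./ m ≡ b ℚ./ n
/-cross a (suc m) b (suc n) eq = ℚ.fromℚᵘ-cong {mkℚᵘ a m} {mkℚᵘ b n} (*≡* eq)

/-cross⁻¹ : ∀ a m b n .{{_ : NonZero m}} .{{_ : NonZero n}} →
            a ℚ./ m ≡ b ℚ./ n → a ℤ.* + n ≡ b ℤ.* + m
/-cross⁻¹ a (suc m) b (suc n) eq = ℚᵘ.drop-*≡* (ℚ.fromℚᵘ-injective {mkℚᵘ a m} {mkℚᵘ b n} eq)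

/-+-/ : ∀ a m b n .{{_ : NonZero m}} .{{_ : NonZero n}} .{{_ : NonZero (m ℕ.* n)}} →
        a ℚ./ m ℚ.+ b ℚ./ n ≡ (a ℤ.* + n ℤ.+ b ℤ.* + m) ℚ./ (m ℕ.* n)
/-+-/ a (suc m) b (suc n) = ℚ.toℚᵘ-injective (begin
  toℚᵘ (a ℚ./ suc m ℚ.+ b ℚ./ suc n)        ≈⟨ ℚ.toℚᵘ-homo-+ (a ℚ./ suc m) (b ℚ./ suc n) ⟩
  toℚᵘ (a ℚ./ suc m) ℚᵘ.+ toℚᵘ (b ℚ./ suc n) ≈⟨ ℚᵘ.+-cong (ℚ.toℚᵘ-fromℚᵘ (mkℚᵘ a m)) (ℚ.toℚᵘ-fromℚᵘ (mkℚᵘ b n)) ⟩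
  mkℚᵘ a m ℚᵘ.+ mkℚᵘ b n                     ≈⟨ ℚ.toℚᵘ-fromℚᵘ (mkℚᵘ a m ℚᵘ.+ mkℚᵘ b n) ⟨
  toℚᵘ (fromℚᵘ (mkℚᵘ a m ℚᵘ.+ mkℚᵘ b n))     ∎)
  where open ℚᵘ.≃-Reasoning

/-neg : ∀ a n .{{_ : NonZero n}} → ℚ.- (a ℚ./ n) ≡ (ℤ.- a) ℚ./ n
/-neg a (suc n) = ℚ.toℚᵘ-injective (begin
  toℚᵘ (ℚ.- (a ℚ./ suc n))    ≈⟨ ℚ.toℚᵘ-homo‿- (a ℚ./ suc n) ⟩
  ℚᵘ.- toℚᵘ (a ℚ./ suc n)     ≈⟨ ℚᵘ.-‿cong (ℚ.toℚᵘ-fromℚᵘ (mkℚᵘ a n)) ⟩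
  mkℚᵘ (ℤ.- a) n              ≈⟨ ℚ.toℚᵘ-fromℚᵘ (mkℚᵘ (ℤ.- a) n) ⟨
  toℚᵘ (ℤ.- a ℚ./ suc n)      ∎)
  where open ℚᵘ.≃-Reasoning

/-+ : ∀ a b n .{{_ : NonZero n}} → a ℚ./ n ℚ.+ b ℚ./ n ≡ (a ℤ.+ b) ℚ./ n
/-+ a b n@(suc _) = ≡.trans (/-+-/ a n b n) (/-cross (a ℤ.* + n ℤ.+ b ℤ.* + n) (n ℕ.* n) (a ℤ.+ b) n eq)
  where
  eq : (a ℤ.* + n ℤ.+ b ℤ.* + n) ℤ.* + n ≡ (a ℤ.+ b) ℤ.* + (n ℕ.* n)
  eq = ≡.trans (lemma a b (+ n)) (cong ((a ℤ.+ b) ℤ.*_) (≡.sym (ℤ.pos-* n n)))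
    where
    lemma : ∀ a b c → (a ℤ.* c ℤ.+ b ℤ.* c) ℤ.* c ≡ (a ℤ.+ b) ℤ.* (c ℤ.* c)
    lemma = solve-∀

/-*-denominator : ∀ a n .{{_ : NonZero n}} → a ℚ./ n ℚ.* (+ n ℚ./ 1) ≡ a ℚ./ 1
/-*-denominator a n@(suc m) = ℚ.toℚᵘ-injective (begin
  toℚᵘ (a ℚ./ n ℚ.* (+ n ℚ./ 1))         ≈⟨ ℚ.toℚᵘ-homo-* (a ℚ./ n) (+ n ℚ./ 1) ⟩
  toℚᵘ (a ℚ./ n) ℚᵘ.* toℚᵘ (+ n ℚ./ 1)   ≈⟨ ℚᵘ.*-cong (ℚ.toℚᵘ-fromℚᵘ (mkℚᵘ a m)) (ℚ.toℚᵘ-fromℚᵘ (mkℚᵘ (+ n) 0)) ⟩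
  mkℚᵘ a m ℚᵘ.* mkℚᵘ (+ n) 0             ≈⟨ *≡* (≡.trans (ℤ.*-identityʳ _) (cong (λ k → a ℤ.* + k) (≡.sym (ℕ.*-identityʳ n)))) ⟩
  mkℚᵘ a 0                               ≈⟨ ℚ.toℚᵘ-fromℚᵘ (mkℚᵘ a 0) ⟨
  toℚᵘ (a ℚ./ 1)                         ∎)
  where open ℚᵘ.≃-Reasoning

/-cross-< : ∀ a m b n .{{_ : NonZero m}} .{{_ : NonZero n}} →
            a ℤ.* + n ℤ.< b ℤ.* + m → a ℚ./ m ℚ.< b ℚ./ n
/-cross-< a (suc m) b (suc n) lt = ℚ.toℚᵘ-cancel-< (ℚᵘ.<-respˡ-≃ (ℚᵘ.≃-sym (ℚ.toℚᵘ-fromℚᵘ (mkℚᵘ a m)))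
  (ℚᵘ.<-respʳ-≃ (ℚᵘ.≃-sym (ℚ.toℚᵘ-fromℚᵘ (mkℚᵘ b n))) (ℚᵘ.*<* lt)))

-- Order and apartness in the field of reals.

module Reals (ℝ : RealNumbers) where
  open RealNumbers ℝ
  open CommutativeRing commutativeRing public using (ring; semiring; rawRing)
  open RingProperties ring public
  open HeytingProperties heytingCommutativeRing public using (x#0y#0→xy#0; 1#0; invertibleʳ⇒#; x-0≈x)
  open IsStrictPartialOrder isStrictPartialOrder public
    using (<-respʳ-≈; <-respˡ-≈) renaming (irrefl to <-irrefl; trans to <-trans)
  open RingMorphisms ℚ.+-*-rawRing rawRing using (module IsRingHomomorphism)
  open IsRingHomomorphism fromℚ-isRingHomomorphism public
    using (+-homo; *-homo; -‿homo; 0#-homo; 1#-homo)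

  fromℚ-weaklyDecidable : ∀ p q → Maybe (fromℚ p ≈ fromℚ q)
  fromℚ-weaklyDecidable p q with p ℚ.≟ q
  ... | yes p≡q = just (reflexive (cong fromℚ p≡q))
  ... | no  _   = nothing

  fromℚ-morphism : ℚ.+-*-rawRing -Raw-AlmostCommutative⟶ fromCommutativeRing commutativeRing
  fromℚ-morphism = record
    { ⟦_⟧ = fromℚ ; +-homo = +-homo ; *-homo = *-homo ; -‿homo = -‿homo ; 0-homo = 0#-homo ; 1-homo = 1#-homo }

  open RingSolver ℚ.+-*-rawRing (fromCommutativeRing commutativeRing) fromℚ-morphism fromℚ-weaklyDecidable public
    using (solve; _:=_; _:+_; _:*_; _:-_; :-_)

  open import Relation.Binary.Reasoning.Setoid setoid

  <⇒≉ : ∀ {x y} → x < y → ¬ (x ≈ y)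
  <⇒≉ x<y x≈y = <-irrefl x≈y x<y

  0<x⇒-x<0 : ∀ {x} → 0# < x → - x < 0#
  0<x⇒-x<0 {x} 0<x = <-respˡ-≈ (+-identityˡ _) (<-respʳ-≈ (-‿inverseʳ x) (+-monoˡ-< 0# x (- x) 0<x))

  x<0⇒0<-x : ∀ {x} → x < 0# → 0# < - x
  x<0⇒0<-x {x} x<0 = <-respʳ-≈ (+-identityˡ _) (<-respˡ-≈ (-‿inverseʳ x) (+-monoˡ-< x 0# (- x) x<0))

  0<y-x⇒x<y : ∀ {x y} → 0# < y - x → x < y
  0<y-x⇒x<y {x} {y} 0<y-x = <-respˡ-≈ (+-identityˡ x)
    (<-respʳ-≈ (solve 2 (λ x y → (y :- x) :+ x := y) refl x y) (+-monoˡ-< 0# (y - x) x 0<y-x))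

  0<x∧0<y⇒0<x+y : ∀ {x y} → 0# < x → 0# < y → 0# < x + y
  0<x∧0<y⇒0<x+y {x} {y} 0<x 0<y = <-trans 0<y (<-respˡ-≈ (+-identityˡ y) (+-monoˡ-< 0# x y 0<x))

  -1*-1≈1 : - 1# * - 1# ≈ 1#
  -1*-1≈1 = trans (solve 1 (λ x → :- x :* :- x := x :* x) refl 1#) (*-identityˡ 1#)

  0<1 : 0# < 1#
  0<1 with Equivalence.to (#⇔<> 1# 0#) 1#0
  ... | inj₂ 0<1 = 0<1
  ... | inj₁ 1<0 = <-respʳ-≈ -1*-1≈1 (*-pos (- 1#) (- 1#) (x<0⇒0<-x 1<0) (x<0⇒0<-x 1<0))

  -- Tightness identifies equality with the negation of apartness, and a negation is stable.
  -- Equations may therefore be proved by contradiction.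
  ≈-stable : ∀ {x y} → ¬ ¬ (x ≈ y) → x ≈ y
  ≈-stable ¬¬x≈y = proj₁ (tight _ _) (λ x#y → ¬¬x≈y (λ x≈y → proj₂ (tight _ _) x≈y x#y))

  -- Tightness of the apartness makes up for the lack of a witness of x # 0.
  x≉0∧xy≈0⇒y≈0 : ∀ {x y} → ¬ (x ≈ 0#) → x * y ≈ 0# → y ≈ 0#
  x≉0∧xy≈0⇒y≈0 x≉0 xy≈0 = proj₁ (tight _ _) λ y#0 →
    x≉0 (proj₁ (tight _ _) λ x#0 → proj₂ (tight _ _) xy≈0 (x#0y#0→xy#0 x#0 y#0))

  x²≈0⇒x≈0 : ∀ {x} → x * x ≈ 0# → x ≈ 0#
  x²≈0⇒x≈0 x²≈0 = ≈-stable (λ x≉0 → x≉0 (x≉0∧xy≈0⇒y≈0 x≉0 x²≈0))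

  0<fromℚ[1+m] : ∀ m → 0# < fromℚ (+[1+ m ] ℚ./ 1)
  0<fromℚ[1+m] zero    = <-respʳ-≈ (sym 1#-homo) 0<1
  0<fromℚ[1+m] (suc m) = <-respʳ-≈ (sym eq) (0<x∧0<y⇒0<x+y 0<1 (0<fromℚ[1+m] m))
    where
    eq : fromℚ (+[1+ suc m ] ℚ./ 1) ≈ 1# + fromℚ (+[1+ m ] ℚ./ 1)
    eq = begin
      fromℚ (+[1+ suc m ] ℚ./ 1)        ≡⟨ cong fromℚ (/-+ (+ 1) +[1+ m ] 1) ⟨
      fromℚ (1ℚ ℚ.+ +[1+ m ] ℚ./ 1)     ≈⟨ +-homo 1ℚ (+[1+ m ] ℚ./ 1) ⟩
      fromℚ 1ℚ + fromℚ (+[1+ m ] ℚ./ 1) ≈⟨ +-congʳ 1#-homo ⟩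
      1# + fromℚ (+[1+ m ] ℚ./ 1)       ∎

  -- `fromℚ` is only assumed to be a ring homomorphism. Since q is invertible, its image is apart
  -- from 0 and so has a sign; a negative sign is refuted by clearing the denominator, as the
  -- numerator is a sum of ones.
  0<q⇒0<fromℚ[q] : ∀ {q} → 0ℚ ℚ.< q → 0# < fromℚ q
  0<q⇒0<fromℚ[q] {q} 0<q = go q (ℚ.positive 0<q)
    where
    go : ∀ q → ℚ.Positive q → 0# < fromℚ q
    go q@(mkℚ +[1+ m ] d _) _ with Equivalence.to (#⇔<> (fromℚ q) 0#) q#0
      where
      q#0 : fromℚ q # 0#
      q#0 = invertibleʳ⇒# (fromℚ (ℚ.1/ q) , (begin
        (fromℚ q - 0#) * fromℚ (ℚ.1/ q) ≈⟨ *-congʳ (x-0≈x (fromℚ q)) ⟩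
        fromℚ q * fromℚ (ℚ.1/ q)        ≈⟨ *-homo q (ℚ.1/ q) ⟨
        fromℚ (q ℚ.* ℚ.1/ q)            ≡⟨ cong fromℚ (ℚ.*-inverseʳ q) ⟩
        fromℚ 1ℚ                        ≈⟨ 1#-homo ⟩
        1#                              ∎))
    ... | inj₂ 0<q = 0<q
    ... | inj₁ q<0 = ⊥-elim (<-irrefl refl (<-trans 0<-m (0<x⇒-x<0 (0<fromℚ[1+m] m))))
      where
      eq : fromℚ q * fromℚ (+[1+ d ] ℚ./ 1) ≈ fromℚ (+[1+ m ] ℚ./ 1)
      eq = trans (sym (*-homo q (+[1+ d ] ℚ./ 1))) (reflexive (cong fromℚ (≡.trans
        (cong (ℚ._* (+[1+ d ] ℚ./ 1)) (≡.sym (ℚ.↥p/↧p≡p q)))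
        (/-*-denominator +[1+ m ] (suc d)))))

      0<-m : 0# < - fromℚ (+[1+ m ] ℚ./ 1)
      0<-m = <-respʳ-≈ (trans (sym (-‿distribˡ-* _ _)) (-‿cong eq))
        (*-pos _ _ (x<0⇒0<-x q<0) (0<fromℚ[1+m] d))

  -- Trigonometric identities from the subtraction formula for cosine.

  module Angles (trig : Trigonometry ℝ) where
    open Trigonometry trig

    α : ℚ → Carrier
    α q = fromℚ q * π

    α-+ : ∀ p q → α (p ℚ.+ q) ≈ α p + α q
    α-+ p q = trans (*-congʳ (+-homo p q)) (distribʳ π _ _)

    α-neg : ∀ q → α (ℚ.- q) ≈ - α q
    α-neg q = trans (*-congʳ (-‿homo q)) (sym (-‿distribˡ-* _ π))

    α-sub : ∀ p q → α (p ℚ.- q) ≈ α p - α q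
    α-sub p q = trans (α-+ p (ℚ.- q)) (+-congˡ (α-neg q))

    0<α : ∀ {q} → 0ℚ ℚ.< q → 0# < α q
    0<α 0<q = *-pos _ π (0<q⇒0<fromℚ[q] 0<q) 0<π

    α-mono-< : ∀ {p q} → p ℚ.< q → α p < α q
    α-mono-< {p} {q} p<q = 0<y-x⇒x<y (<-respʳ-≈ (α-sub q p) (0<α
      (subst (ℚ._< q ℚ.- p) (ℚ.+-inverseʳ p) (ℚ.+-monoˡ-< (ℚ.- p) p<q))))

    -- The order of ℚ is decidable and `α` is strictly increasing, so equal angles can be traced
    -- back to equal fractions.
    α-injective : ∀ {p q} → α p ≈ α q → p ≡ q
    α-injective {p} {q} αp≈αq with ℚ.<-cmp p q
    ... | tri< p<q _ _ = ⊥-elim (<⇒≉ (α-mono-< p<q) αp≈αq)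
    ... | tri≈ _ p≡q _ = p≡q
    ... | tri> _ _ q<p = ⊥-elim (<⇒≉ (α-mono-< q<p) (sym αp≈αq))

    cos²+sin²≈1 : ∀ x → cos x * cos x + sin x * sin x ≈ 1#
    cos²+sin²≈1 x = trans (sym (cos-sub x x)) (trans (cos-cong (-‿inverseʳ x)) cos-0)

    sin²≈1-cos² : ∀ x → sin x * sin x ≈ 1# - cos x * cos x
    sin²≈1-cos² x = begin
      sin x * sin x                                       ≈⟨ solve 2 (λ c s → s := (c :+ s) :- c) refl _ _ ⟩
      (cos x * cos x + sin x * sin x) - cos x * cos x     ≈⟨ +-congʳ (cos²+sin²≈1 x) ⟩
      1# - cos x * cos x                                  ∎

    cos≈1⇒sin≈0 : ∀ {x} → cos x ≈ 1# → sin x ≈ 0#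
    cos≈1⇒sin≈0 {x} cos≈1 = x²≈0⇒x≈0 (begin
      sin x * sin x      ≈⟨ sin²≈1-cos² x ⟩
      1# - cos x * cos x ≈⟨ +-congˡ (-‿cong (*-cong cos≈1 cos≈1)) ⟩
      1# - 1# * 1#       ≈⟨ +-congˡ (-‿cong (*-identityˡ 1#)) ⟩
      1# - 1#            ≈⟨ -‿inverseʳ 1# ⟩
      0#                 ∎)

    sin-π≈0 : sin π ≈ 0#
    sin-π≈0 = x²≈0⇒x≈0 (begin
      sin π * sin π      ≈⟨ sin²≈1-cos² π ⟩
      1# - cos π * cos π ≈⟨ +-congˡ (-‿cong (*-cong cos-π cos-π)) ⟩
      1# - - 1# * - 1#   ≈⟨ +-congˡ (-‿cong -1*-1≈1) ⟩
      1# - 1#            ≈⟨ -‿inverseʳ 1# ⟩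
      0#                 ∎)

    cos-π/2≈0 : cos π/2 ≈ 0#
    cos-π/2≈0 = x²≈0⇒x≈0 (begin
      cos π/2 * cos π/2                                                 ≈⟨ solve 2 (λ c s → c := (c :+ s) :- s) refl _ _ ⟩
      (cos π/2 * cos π/2 + sin π/2 * sin π/2) - sin π/2 * sin π/2       ≈⟨ +-cong (cos²+sin²≈1 π/2) (-‿cong (*-cong sin-π/2 sin-π/2)) ⟩
      1# - 1# * 1#                                                      ≈⟨ +-congˡ (-‿cong (*-identityˡ 1#)) ⟩
      1# - 1#                                                           ≈⟨ -‿inverseʳ 1# ⟩
      0#                                                                ∎)

    sin≈cos[π/2-] : ∀ x → cos (π/2 - x) ≈ sin x
    sin≈cos[π/2-] x = begin
      cos (π/2 - x)                         ≈⟨ cos-sub x π/2 ⟩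
      cos π/2 * cos x + sin π/2 * sin x     ≈⟨ +-cong (*-congʳ cos-π/2≈0) (*-congʳ sin-π/2) ⟩
      0# * cos x + 1# * sin x               ≈⟨ +-cong (zeroˡ _) (*-identityˡ _) ⟩
      0# + sin x                            ≈⟨ +-identityˡ _ ⟩
      sin x                                 ∎

    sin-0 : sin 0# ≈ 0#
    sin-0 = cos≈1⇒sin≈0 cos-0

    cos-even : ∀ x → cos (- x) ≈ cos x
    cos-even x = begin
      cos (- x)                       ≈⟨ cos-cong (+-identityˡ (- x)) ⟨
      cos (0# - x)                    ≈⟨ cos-sub x 0# ⟩
      cos 0# * cos x + sin 0# * sin x ≈⟨ +-cong (*-congʳ cos-0) (*-congʳ sin-0) ⟩
      1# * cos x + 0# * sin x         ≈⟨ +-cong (*-identityˡ _) (zeroˡ _) ⟩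
      cos x + 0#                      ≈⟨ +-identityʳ _ ⟩
      cos x                           ∎

    π≈π/2+π/2 : π ≈ π/2 + π/2
    π≈π/2+π/2 = trans (sym (trans (*-congʳ 1#-homo) (*-identityˡ π))) (α-+ (+ 1 ℚ./ 2) (+ 1 ℚ./ 2))

    -- The subtraction formula at π/2 and -π/2 reads cos π = sin (-π/2), because cos π/2 vanishes
    -- and sin π/2 is 1.
    sin-[-π/2] : sin (- π/2) ≈ - 1#
    sin-[-π/2] = begin
      sin (- π/2)                                       ≈⟨ +-identityˡ _ ⟨
      0# + sin (- π/2)                                  ≈⟨ +-cong (zeroˡ _) (*-identityˡ _) ⟨
      0# * cos (- π/2) + 1# * sin (- π/2)               ≈⟨ +-cong (*-congʳ cos-π/2≈0) (*-congʳ sin-π/2) ⟨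
      cos π/2 * cos (- π/2) + sin π/2 * sin (- π/2)     ≈⟨ cos-sub (- π/2) π/2 ⟨
      cos (π/2 - - π/2)                                 ≈⟨ cos-cong (trans (+-congˡ (-‿involutive π/2)) (sym π≈π/2+π/2)) ⟩
      cos π                                             ≈⟨ cos-π ⟩
      - 1#                                              ∎

    cos[x+π/2] : ∀ x → cos (x + π/2) ≈ - sin x
    cos[x+π/2] x = begin
      cos (x + π/2)                                     ≈⟨ cos-cong (+-congˡ (-‿involutive π/2)) ⟨
      cos (x - - π/2)                                   ≈⟨ cos-sub (- π/2) x ⟩
      cos x * cos (- π/2) + sin x * sin (- π/2)         ≈⟨ +-cong (*-congˡ (trans (cos-even π/2) cos-π/2≈0)) (*-congˡ sin-[-π/2]) ⟩
      cos x * 0# + sin x * - 1#                         ≈⟨ +-cong (zeroʳ _) (trans (sym (-‿distribʳ-* _ _)) (-‿cong (*-identityʳ _))) ⟩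
      0# - sin x                                        ≈⟨ +-identityˡ _ ⟩
      - sin x                                           ∎

    -- The addition formulas are not yet available, so the sign is obtained by a quarter turn: sin
    -- (-x) = cos (π/2 + x), and the latter is computed by subtracting -π/2.
    sin-odd : ∀ x → sin (- x) ≈ - sin x
    sin-odd x = begin
      sin (- x)         ≈⟨ sin≈cos[π/2-] (- x) ⟨
      cos (π/2 - - x)   ≈⟨ cos-cong (trans (+-congˡ (-‿involutive x)) (+-comm π/2 x)) ⟩
      cos (x + π/2)     ≈⟨ cos[x+π/2] x ⟩
      - sin x           ∎

    cos-add : ∀ x y → cos (y + x) ≈ cos y * cos x - sin y * sin x
    cos-add x y = begin
      cos (y + x)                               ≈⟨ cos-cong (+-congˡ (-‿involutive x)) ⟨
      cos (y - - x)                             ≈⟨ cos-sub (- x) y ⟩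
      cos y * cos (- x) + sin y * sin (- x)     ≈⟨ +-cong (*-congˡ (cos-even x)) (*-congˡ (sin-odd x)) ⟩
      cos y * cos x + sin y * - sin x           ≈⟨ +-congˡ (-‿distribʳ-* _ _) ⟨
      cos y * cos x - sin y * sin x             ∎

    sin-sub : ∀ x y → sin (y - x) ≈ sin y * cos x - cos y * sin x
    sin-sub x y = begin
      sin (y - x)                                     ≈⟨ sin≈cos[π/2-] (y - x) ⟨
      -- Sine is the cosine of the complement, and the complement of y - x is (π/2 - y) + x.
      cos (π/2 - (y - x))                             ≈⟨ cos-cong (solve 3 (λ h x y → h :- (y :- x) := (h :- y) :+ x) refl π/2 x y) ⟩
      cos ((π/2 - y) + x)                             ≈⟨ cos-add x (π/2 - y) ⟩
      cos (π/2 - y) * cos x - sin (π/2 - y) * sin x   ≈⟨ +-cong (*-congʳ (sin≈cos[π/2-] y)) (-‿cong (*-congʳ sin[π/2-y])) ⟩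
      sin y * cos x - cos y * sin x                   ∎
      where
      sin[π/2-y] : sin (π/2 - y) ≈ cos y
      sin[π/2-y] = trans (sym (sin≈cos[π/2-] (π/2 - y)))
        (cos-cong (solve 2 (λ h y → h :- (h :- y) := y) refl π/2 y))

    -- cos 2x = 1 - 2 sin² x.
    cos[x+x]≉1 : ∀ {x} → 0# < x → x < π/2 → ¬ (cos (x + x) ≈ 1#)
    cos[x+x]≉1 {x} 0<x x<π/2 cos≈1 = <⇒≉ (0<x∧0<y⇒0<x+y (*-pos _ _ 0<sin 0<sin) (*-pos _ _ 0<sin 0<sin)) (sym (begin
      sin x * sin x + sin x * sin x ≈⟨ solve 2 (λ c s → s :+ s := (c :+ s) :- (c :- s)) refl (cos x * cos x) (sin x * sin x) ⟩
      (cos x * cos x + sin x * sin x) - (cos x * cos x - sin x * sin x) ≈⟨ +-cong (cos²+sin²≈1 x) (-‿cong (trans (sym (cos-add x x)) cos≈1)) ⟩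
      1# - 1#                       ≈⟨ -‿inverseʳ 1# ⟩
      0#                            ∎))
      where
      0<sin : 0# < sin x
      0<sin = <-trans (*-pos x (cos x) 0<x (0<cos x 0<x x<π/2)) (xcos<sin x 0<x x<π/2)

-- Residues modulo n.

∣-resp-≡ : ∀ {k a b} → a ≡ b → k ∣ℤ a → k ∣ℤ b
∣-resp-≡ {k} = subst (k ∣ℤ_)

toℕ-∣-injective : ∀ {n} {i j : Fin n} → + n ∣ℤ + toℕ i ℤ.- + toℕ j → i ≡ j
toℕ-∣-injective {n} {i} {j} n∣i-j = Fin.toℕ-injective (ℤ.+-injective (ℤ.i-j≡0⇒i≡j (+ toℕ i) (+ toℕ j) (ℤ.∣i∣≡0⇒i≡0 small)))
  where
  bound : ℤ.∣ + toℕ i ℤ.- + toℕ j ∣ ℕ.< n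
  bound = ℕ.≤-<-trans (ℕ.≤-trans (ℕ.≤-reflexive (cong ℤ.∣_∣ (ℤ.m-n≡m⊖n (toℕ i) (toℕ j)))) (ℤ.∣m⊝n∣≤m⊔n (toℕ i) (toℕ j)))
    (ℕ.⊔-pres-<m (Fin.toℕ<n i) (Fin.toℕ<n j))

  small : ℤ.∣ + toℕ i ℤ.- + toℕ j ∣ ≡ 0
  small with ℤ.∣ + toℕ i ℤ.- + toℕ j ∣ in eq
  ... | zero  = ≡.refl
  ... | suc k = contradiction (subst (n ℕ.∣_) eq (∣⇒∣ᵤ n∣i-j)) (ℕ.>⇒∤ (subst (ℕ._< n) eq bound))

module _ (n : ℕ) .{{n≢0 : NonZero n}} where

  residue-∣ : ∀ z → + n ∣ℤ + toℕ (residue n z) ℤ.- z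
  residue-∣ z = ∣-resp-≡ eq (∣m⇒∣-m (∣n⇒∣m*n (z ℤ./ℕ n) (divides (+ 1) (≡.sym (ℤ.*-identityˡ (+ n))))))
    where
    lemma : ∀ a b → ℤ.- b ≡ a ℤ.- (a ℤ.+ b)
    lemma = solve-∀

    eq : ℤ.- ((z ℤ./ℕ n) ℤ.* + n) ≡ + toℕ (residue n z) ℤ.- z
    eq = ≡.trans (lemma (+ (z ℤ.%ℕ n)) _) (cong₂ (λ a b → + a ℤ.- b)
      (≡.sym (Fin.toℕ-fromℕ< (n%ℕd<d z n))) (≡.sym (a≡a%ℕn+[a/ℕn]*n z n)))

  residue-unique : ∀ z i → + n ∣ℤ z ℤ.- + toℕ i → residue n z ≡ i
  residue-unique z i n∣z-i = toℕ-∣-injective (∣-resp-≡ (lemma (+ toℕ (residue n z)) z (+ toℕ i)) (∣m∣n⇒∣m+n (residue-∣ z) n∣z-i))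
    where
    lemma : ∀ a b c → (a ℤ.- b) ℤ.+ (b ℤ.- c) ≡ a ℤ.- c
    lemma = solve-∀

  residue-cong : ∀ y z → + n ∣ℤ y ℤ.- z → residue n y ≡ residue n z
  residue-cong y z n∣y-z = residue-unique y _ (∣-resp-≡ (lemma y z _) (∣m∣n⇒∣m-n n∣y-z (residue-∣ z)))
    where
    lemma : ∀ a b c → (a ℤ.- b) ℤ.- (c ℤ.- b) ≡ a ℤ.- c
    lemma = solve-∀

  residue-injective : ∀ y z → residue n y ≡ residue n z → + n ∣ℤ y ℤ.- z
  residue-injective y z eq = ∣-resp-≡ (lemma (+ toℕ (residue n z)) y z) (∣m∣n⇒∣m-n (residue-∣ z)
    (subst (λ r → + n ∣ℤ + toℕ r ℤ.- y) eq (residue-∣ y)))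
    where
    lemma : ∀ a b c → (a ℤ.- c) ℤ.- (a ℤ.- b) ≡ b ℤ.- c
    lemma = solve-∀

  -- The map i ↦ z - i is its own inverse, so it gives a permutation without further work. It serves
  -- as negation (z = 0), as the substitution in convolutions, and, with z = v, as the difference v
  -- - u tested for adjacency.
  reflect : ℤ → Fin n → Fin n
  reflect z i = residue n (z ℤ.- + toℕ i)

  reflect-involutive : ∀ z i → reflect z (reflect z i) ≡ i
  reflect-involutive z i = residue-unique (z ℤ.- + toℕ (reflect z i)) i (∣-resp-≡ (lemma z (+ toℕ (reflect z i)) (+ toℕ i)) (∣m⇒∣-m (residue-∣ (z ℤ.- + toℕ i))))
    where
    lemma : ∀ z r i → ℤ.- (r ℤ.- (z ℤ.- i)) ≡ (z ℤ.- r) ℤ.- i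
    lemma = solve-∀

  reflection : ℤ → Permutation′ n
  reflection z = permutation (reflect z) (reflect z) (reflect-involutive z) (reflect-involutive z)

-- Fourier analysis on ℤₙ with cosines and sines.

module Fourier (ℝ : RealNumbers) (trig : Trigonometry ℝ) (n : ℕ) .{{n≢0 : NonZero n}} where
  open RealNumbers ℝ
  open Trigonometry trig
  open Reals ℝ
  open Angles trig
  open Sum semiring
  open import Relation.Binary.Reasoning.Setoid setoid

  -- χ_j(x) = C (x j) + i S (x j).
  angle : ℤ → ℚ
  angle a = (+ 2 ℤ.* a) ℚ./ n

  C S : ℤ → Carrier
  C a = cos (α (angle a))
  S a = sin (α (angle a))

  angle-sub : ∀ a b → angle a ℚ.- angle b ≡ angle (a ℤ.- b)
  angle-sub a b = ≡.trans (cong (angle a ℚ.+_) (/-neg (+ 2 ℤ.* b) n))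
    (≡.trans (/-+ (+ 2 ℤ.* a) (ℤ.- (+ 2 ℤ.* b)) n) (cong (ℚ._/ n) (lemma a b)))
    where
    lemma : ∀ a b → + 2 ℤ.* a ℤ.+ ℤ.- (+ 2 ℤ.* b) ≡ + 2 ℤ.* (a ℤ.- b)
    lemma = solve-∀

  α-angle-sub : ∀ a b → α (angle (a ℤ.- b)) ≈ α (angle a) - α (angle b)
  α-angle-sub a b = trans (reflexive (cong α (≡.sym (angle-sub a b)))) (α-sub (angle a) (angle b))

  C-sub : ∀ a b → C (a ℤ.- b) ≈ C a * C b + S a * S b
  C-sub a b = trans (cos-cong (α-angle-sub a b)) (cos-sub (α (angle b)) (α (angle a)))

  S-sub : ∀ a b → S (a ℤ.- b) ≈ S a * C b - C a * S b
  S-sub a b = trans (sin-cong (α-angle-sub a b)) (sin-sub (α (angle b)) (α (angle a)))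

  α[0]≈0 : α (angle (+ 0)) ≈ 0#
  α[0]≈0 = trans (*-congʳ (trans (reflexive (cong fromℚ (/-cross (+ 0) n (+ 0) 1 ≡.refl))) 0#-homo)) (zeroˡ π)

  C-0 : C (+ 0) ≈ 1#
  C-0 = trans (cos-cong α[0]≈0) cos-0

  C[n]≈1 : C (+ n) ≈ 1#
  C[n]≈1 = begin
    cos (α (angle (+ n)))           ≡⟨ cong (cos ∘ α) (/-cross (+ 2 ℤ.* + n) n (+ 2) 1 (ℤ.*-identityʳ _)) ⟩
    cos (α (1ℚ ℚ.+ 1ℚ))             ≈⟨ cos-cong (trans (α-+ 1ℚ 1ℚ) (+-cong α1≈π α1≈π)) ⟩
    cos (π + π)                     ≈⟨ cos-add π π ⟩
    cos π * cos π - sin π * sin π   ≈⟨ +-cong (*-cong cos-π cos-π) (-‿cong (*-congˡ sin-π≈0)) ⟩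
    - 1# * - 1# - sin π * 0#        ≈⟨ +-cong -1*-1≈1 (-‿cong (zeroʳ _)) ⟩
    1# - 0#                         ≈⟨ x-0≈x 1# ⟩
    1#                              ∎
    where
    α1≈π : α 1ℚ ≈ π
    α1≈π = trans (*-congʳ 1#-homo) (*-identityˡ π)

  -- The integers a with `C a ≈ 1#` thus form a subgroup of ℤ; as it contains n, it contains every
  -- multiple of n.
  C≈1-sub : ∀ a b → C a ≈ 1# → C b ≈ 1# → C (a ℤ.- b) ≈ 1#
  C≈1-sub a b Ca≈1 Cb≈1 = begin
    C (a ℤ.- b)           ≈⟨ C-sub a b ⟩
    C a * C b + S a * S b ≈⟨ +-cong (*-cong Ca≈1 Cb≈1) (*-congˡ (cos≈1⇒sin≈0 Cb≈1)) ⟩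
    1# * 1# + S a * 0#    ≈⟨ +-cong (*-identityˡ 1#) (zeroʳ _) ⟩
    1# + 0#               ≈⟨ +-identityʳ 1# ⟩
    1#                    ∎

  C≈1-neg : ∀ a → C a ≈ 1# → C (ℤ.- a) ≈ 1#
  C≈1-neg a Ca≈1 = trans (reflexive (cong C (≡.sym (ℤ.+-identityˡ (ℤ.- a))))) (C≈1-sub (+ 0) a C-0 Ca≈1)

  C[mn]≈1 : ∀ m → C (+ m ℤ.* + n) ≈ 1#
  C[mn]≈1 zero    = C-0
  C[mn]≈1 (suc m) = trans (reflexive (cong C (lemma (+ m) (+ n)))) (C≈1-sub (+ n) (ℤ.- (+ m ℤ.* + n)) C[n]≈1 (C≈1-neg (+ m ℤ.* + n) (C[mn]≈1 m)))
    where
    lemma : ∀ m n → (+ 1 ℤ.+ m) ℤ.* n ≡ n ℤ.- ℤ.- (m ℤ.* n)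
    lemma = solve-∀

  ∣⇒C≈1 : ∀ a → + n ∣ℤ a → C a ≈ 1#
  ∣⇒C≈1 _ (divides (+ m)    ≡.refl) = C[mn]≈1 m
  ∣⇒C≈1 _ (divides -[1+ m ] ≡.refl) = trans (reflexive (cong C (≡.sym (ℤ.neg-distribˡ-* +[1+ m ] (+ n))))) (C≈1-neg (+[1+ m ] ℤ.* + n) (C[mn]≈1 (suc m)))

  private
    a-[a-b]≡b : ∀ a b → a ℤ.- (a ℤ.- b) ≡ b
    a-[a-b]≡b = solve-∀

  -- Writing b as a - (a - b) lets the subtraction formula apply, with cosine 1 and sine 0 at the
  -- multiple a - b of n.
  C-cong-∣ : ∀ a b → + n ∣ℤ a ℤ.- b → C a ≈ C b
  C-cong-∣ a b n∣a-b = sym (begin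
    C b                                       ≡⟨ cong C (a-[a-b]≡b a b) ⟨
    C (a ℤ.- (a ℤ.- b))                       ≈⟨ C-sub a (a ℤ.- b) ⟩
    C a * C (a ℤ.- b) + S a * S (a ℤ.- b)     ≈⟨ +-cong (*-congˡ C≈1) (*-congˡ (cos≈1⇒sin≈0 C≈1)) ⟩
    C a * 1# + S a * 0#                       ≈⟨ +-cong (*-identityʳ _) (zeroʳ _) ⟩
    C a + 0#                                  ≈⟨ +-identityʳ _ ⟩
    C a                                       ∎)
    where C≈1 = ∣⇒C≈1 (a ℤ.- b) n∣a-b

  S-cong-∣ : ∀ a b → + n ∣ℤ a ℤ.- b → S a ≈ S b
  S-cong-∣ a b n∣a-b = sym (begin
    S b                                       ≡⟨ cong S (a-[a-b]≡b a b) ⟨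
    S (a ℤ.- (a ℤ.- b))                       ≈⟨ S-sub a (a ℤ.- b) ⟩
    S a * C (a ℤ.- b) - C a * S (a ℤ.- b)     ≈⟨ +-cong (*-congˡ C≈1) (-‿cong (*-congˡ (cos≈1⇒sin≈0 C≈1))) ⟩
    S a * 1# - C a * 0#                       ≈⟨ +-cong (*-identityʳ _) (-‿cong (zeroʳ _)) ⟩
    S a - 0#                                  ≈⟨ x-0≈x _ ⟩
    S a                                       ∎)
    where C≈1 = ∣⇒C≈1 (a ℤ.- b) n∣a-b

  S-odd : ∀ a → S (ℤ.- a) ≈ - S a
  S-odd a = trans (sin-cong (begin
    α (angle (ℤ.- a))                     ≡⟨ cong (α ∘ angle) (ℤ.+-identityˡ (ℤ.- a)) ⟨
    α (angle (+ 0 ℤ.- a))                 ≈⟨ α-angle-sub (+ 0) a ⟩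
    α (angle (+ 0)) - α (angle a)         ≈⟨ +-congʳ α[0]≈0 ⟩
    0# - α (angle a)                      ≈⟨ +-identityˡ _ ⟩
    - α (angle a)                         ∎)) (sin-odd (α (angle a)))

  0<2m<n⇒C≉1 : ∀ {m} → 0 ℕ.< m → m ℕ.+ m ℕ.< n → ¬ (C (+ m) ≈ 1#)
  0<2m<n⇒C≉1 {m} 0<m 2m<n C≈1 = cos[x+x]≉1 (0<α 0<m/n) (α-mono-< m/n<1/2) (trans (cos-cong (begin
    α (+ m ℚ./ n) + α (+ m ℚ./ n)     ≈⟨ α-+ (+ m ℚ./ n) (+ m ℚ./ n) ⟨
    α (+ m ℚ./ n ℚ.+ + m ℚ./ n)       ≡⟨ cong α (≡.trans (/-+ (+ m) (+ m) n) (cong (ℚ._/ n) (lemma (+ m)))) ⟩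
    α (angle (+ m))                   ∎)) C≈1)
    where
    lemma : ∀ m → m ℤ.+ m ≡ + 2 ℤ.* m
    lemma = solve-∀

    0<m/n : 0ℚ ℚ.< + m ℚ./ n
    0<m/n = /-cross-< (+ 0) 1 (+ m) n (subst (+ 0 ℤ.<_) (≡.sym (ℤ.*-identityʳ (+ m))) (ℤ.+<+ 0<m))

    m/n<1/2 : + m ℚ./ n ℚ.< + 1 ℚ./ 2
    m/n<1/2 = /-cross-< (+ m) n (+ 1) 2 (≡.subst₂ ℤ._<_ (≡.trans (lemma (+ m)) (ℤ.*-comm (+ 2) (+ m))) (≡.sym (ℤ.*-identityˡ (+ n))) (ℤ.+<+ 2m<n))

  -- The inequalities for sine and cosine are available only on (0, π/2), which after halving the
  -- angle covers 2 m < n. The case 2 m = n is cos π = -1, and 2 m > n is folded back by m ↦ n - m.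
  0<m<n⇒C≉1 : ∀ {m} → 0 ℕ.< m → m ℕ.< n → ¬ (C (+ m) ≈ 1#)
  0<m<n⇒C≉1 {m} 0<m m<n C≈1 with ℕ.<-cmp (m ℕ.+ m) n
  ... | tri< 2m<n _ _ = 0<2m<n⇒C≉1 0<m 2m<n C≈1
  ... | tri≈ _ 2m≡n _ = <⇒≉ (0<x∧0<y⇒0<x+y 0<1 0<1) (sym (begin
    1# + 1#       ≈⟨ +-congʳ (trans (sym C≈1) C≈-1) ⟩
    - 1# + 1#     ≈⟨ -‿inverseˡ 1# ⟩
    0#            ∎))
    where
    lemma : ∀ m → (m ℤ.+ m) ≡ + 2 ℤ.* m
    lemma = solve-∀

    angle≡1 : angle (+ m) ≡ 1ℚ
    angle≡1 = /-cross (+ 2 ℤ.* + m) n (+ 1) 1 (≡.trans (ℤ.*-identityʳ _)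
      (≡.trans (≡.sym (lemma (+ m))) (≡.trans (cong +_ 2m≡n) (≡.sym (ℤ.*-identityˡ (+ n))))))

    C≈-1 : C (+ m) ≈ - 1#
    C≈-1 = trans (cos-cong (trans (reflexive (cong α angle≡1)) (trans (*-congʳ 1#-homo) (*-identityˡ π)))) cos-π
  ... | tri> _ _ n<2m = 0<2m<n⇒C≉1 (ℕ.m<n⇒0<n∸m m<n) 2[n-m]<n
    (trans (C-cong-∣ (+ (n ℕ.∸ m)) (ℤ.- + m) n∣) (C≈1-neg (+ m) C≈1))
    where
    lemma : ∀ a b → a ≡ (a ℤ.- b) ℤ.- ℤ.- b
    lemma = solve-∀

    n∣ : + n ∣ℤ + (n ℕ.∸ m) ℤ.- ℤ.- + m
    n∣ = divides (+ 1) (≡.trans (cong (ℤ._- ℤ.- + m) (≡.trans (≡.sym (ℤ.⊖-≥ (ℕ.<⇒≤ m<n))) (≡.sym (ℤ.m-n≡m⊖n n m))))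
      (≡.trans (≡.sym (lemma (+ n) (+ m))) (≡.sym (ℤ.*-identityˡ (+ n)))))

    2[n-m]<n : (n ℕ.∸ m) ℕ.+ (n ℕ.∸ m) ℕ.< n
    2[n-m]<n = ℕ.<-≤-trans (ℕ.+-monoʳ-< (n ℕ.∸ m) n-m<m) (ℕ.≤-reflexive (ℕ.m∸n+n≡m (ℕ.<⇒≤ m<n)))
      where
      n-m<m : n ℕ.∸ m ℕ.< m
      n-m<m = ℕ.m<n+o⇒m∸n<o n m {{ℕ.>-nonZero 0<m}} n<2m

  C≈1⇒∣ : ∀ a → C a ≈ 1# → + n ∣ℤ a
  C≈1⇒∣ a C≈1 with toℕ (residue n a) in eq | residue-∣ n a
  ... | zero  | n∣0-a = ∣-resp-≡ (≡.trans (cong ℤ.-_ (ℤ.+-identityˡ (ℤ.- a))) (ℤ.neg-involutive a)) (∣m⇒∣-m n∣0-a)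
  ... | suc r | n∣r-a = contradiction (trans (C-cong-∣ +[1+ r ] a n∣r-a) C≈1)
    (0<m<n⇒C≉1 ℕ.z<s (subst (ℕ._< n) eq (Fin.toℕ<n (residue n a))))

  sum-cong : ∀ {m} {f g : Fin m → Carrier} → (∀ i → f i ≈ g i) → sum f ≈ sum g
  sum-cong f≈g = sum-cong-≋ f≈g

  sum-zero : ∀ {m} {f : Fin m → Carrier} → (∀ i → f i ≈ 0#) → sum f ≈ 0#
  sum-zero {m} f≈0 = trans (sum-cong f≈0) (sum-replicate-zero m)

  sum-single : ∀ {m} (f : Fin m → Carrier) i → (∀ j → j ≢ i → f j ≈ 0#) → sum f ≈ f i
  sum-single {suc m} f i f≈0 = begin
    sum f                           ≈⟨ sum-remove {i = i} f ⟩
    f i + sum (f ∘ punchIn i)       ≈⟨ +-congˡ (sum-zero (λ j → f≈0 (punchIn i j) (Fin.punchInᵢ≢i i j))) ⟩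
    f i + 0#                        ≈⟨ +-identityʳ (f i) ⟩
    f i                             ∎

  indicator : ∀ {P : Set} → Dec P → Carrier
  indicator P? = if does P? then 1# else 0#

  indicator-true : ∀ {P : Set} (P? : Dec P) → P → indicator P? ≈ 1#
  indicator-true (yes _) _ = refl
  indicator-true (no ¬p) p = contradiction p ¬p

  indicator-false : ∀ {P : Set} (P? : Dec P) → ¬ P → indicator P? ≈ 0#
  indicator-false (yes p) ¬p = contradiction p ¬p
  indicator-false (no _)  _  = refl

  indicator-⇔ : ∀ {P Q : Set} (P? : Dec P) (Q? : Dec Q) → (P → Q) → (Q → P) → indicator P? ≈ indicator Q?
  indicator-⇔ (yes p) Q? f g = sym (indicator-true Q? (f p))
  indicator-⇔ (no ¬p) Q? f g = sym (indicator-false Q? (¬p ∘ g))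

  indicator-⊎ : ∀ {P Q : Set} (P? : Dec P) (Q? : Dec Q) → ¬ (P × Q) →
                indicator (P? ⊎-dec Q?) ≈ indicator P? + indicator Q?
  indicator-⊎ (yes p) (yes q) ¬pq = contradiction (p , q) ¬pq
  indicator-⊎ (yes p) (no _)  _   = sym (+-identityʳ 1#)
  indicator-⊎ (no _)  (yes _) _   = sym (+-identityˡ 1#)
  indicator-⊎ (no _)  (no _)  _   = sym (+-identityˡ 0#)

  Symmetric : (Fin n → Carrier) → Set
  Symmetric f = ∀ s → f (reflect n (+ 0) s) ≈ f s

  toℕ-reflect-∣ : ∀ z y a s → + n ∣ℤ (+ toℕ (reflect n z s) ℤ.- y) ℤ.* a ℤ.- ((z ℤ.- y) ℤ.* a ℤ.- + toℕ s ℤ.* a)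
  toℕ-reflect-∣ z y a s = ∣-resp-≡ (lemma (+ toℕ (reflect n z s)) y z (+ toℕ s) a) (∣m⇒∣m*n a (residue-∣ n (z ℤ.- + toℕ s)))
    where
    lemma : ∀ r y z s a → (r ℤ.- (z ℤ.- s)) ℤ.* a ≡ (r ℤ.- y) ℤ.* a ℤ.- ((z ℤ.- y) ℤ.* a ℤ.- s ℤ.* a)
    lemma = solve-∀

  -- The substitution s ↦ -s turns the sum into its own negative.
  sine-sum≈0 : ∀ {f} → Symmetric f → ∀ a → sum (λ s → f s * S (+ toℕ s ℤ.* a)) ≈ 0#
  sine-sum≈0 {f} f-sym a = x≈-x⇒x≈0 (begin
    sum F                       ≈⟨ sum-permute F (reflection n (+ 0)) ⟩
    sum (F ∘ reflect n (+ 0))   ≈⟨ sum-cong odd ⟩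
    sum (λ s → - 1# * F s)      ≈⟨ *-distribˡ-sum (- 1#) F ⟨
    - 1# * sum F                ≈⟨ -1*x≈-x (sum F) ⟩
    - sum F                     ∎)
    where
    F : Fin n → Carrier
    F s = f s * S (+ toℕ s ℤ.* a)

    x≈-x⇒x≈0 : ∀ {x} → x ≈ - x → x ≈ 0#
    x≈-x⇒x≈0 {x} x≈-x = x≉0∧xy≈0⇒y≈0 (λ 2≈0 → <⇒≉ (0<x∧0<y⇒0<x+y 0<1 0<1) (sym 2≈0)) (begin
      (1# + 1#) * x     ≈⟨ distribʳ x 1# 1# ⟩
      1# * x + 1# * x   ≈⟨ +-cong (*-identityˡ x) (trans (*-identityˡ x) x≈-x) ⟩
      x - x             ≈⟨ -‿inverseʳ x ⟩
      0#                ∎)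

    odd : ∀ s → F (reflect n (+ 0) s) ≈ - 1# * F s
    odd s = begin
      f s′ * S (+ toℕ s′ ℤ.* a)        ≈⟨ *-cong (f-sym s) (trans (S-cong-∣ (+ toℕ s′ ℤ.* a) (ℤ.- (+ toℕ s ℤ.* a)) n∣) (S-odd (+ toℕ s ℤ.* a))) ⟩
      f s * - S (+ toℕ s ℤ.* a)        ≈⟨ -‿distribʳ-* _ _ ⟨
      - F s                            ≈⟨ -1*x≈-x (F s) ⟨
      - 1# * F s                       ∎
      where
      s′ = reflect n (+ 0) s

      lemma : ∀ r s a → (r ℤ.- (+ 0 ℤ.- s)) ℤ.* a ≡ r ℤ.* a ℤ.- ℤ.- (s ℤ.* a)
      lemma = solve-∀

      n∣ : + n ∣ℤ + toℕ s′ ℤ.* a ℤ.- ℤ.- (+ toℕ s ℤ.* a)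
      n∣ = ∣-resp-≡ (lemma (+ toℕ s′) (+ toℕ s) a) (∣m⇒∣m*n a (residue-∣ n (+ 0 ℤ.- + toℕ s)))

  -- For symmetric f the sine part of the addition formula sums to zero.
  convolution : ∀ {f} → Symmetric f → ∀ z y a →
    sum (λ u → f (reflect n z u) * C ((+ toℕ u ℤ.- y) ℤ.* a)) ≈
    C ((z ℤ.- y) ℤ.* a) * sum (λ s → f s * C (+ toℕ s ℤ.* a))
  convolution {f} f-sym z y a = begin
    sum F                                                 ≈⟨ sum-permute F (reflection n z) ⟩
    sum (F ∘ reflect n z)                                 ≈⟨ sum-cong expand ⟩
    sum (λ s → c * (f s * C′ s) + c′ * (f s * S′ s))       ≈⟨ ∑-distrib-+ (λ s → c * (f s * C′ s)) (λ s → c′ * (f s * S′ s)) ⟩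
    sum (λ s → c * (f s * C′ s)) + sum (λ s → c′ * (f s * S′ s)) ≈⟨ +-cong (*-distribˡ-sum c (λ s → f s * C′ s)) (*-distribˡ-sum c′ (λ s → f s * S′ s)) ⟨
    c * sum (λ s → f s * C′ s) + c′ * sum (λ s → f s * S′ s) ≈⟨ +-congˡ (trans (*-congˡ (sine-sum≈0 f-sym a)) (zeroʳ c′)) ⟩
    c * sum (λ s → f s * C′ s) + 0#                       ≈⟨ +-identityʳ _ ⟩
    c * sum (λ s → f s * C′ s)                            ∎
    where
    F : Fin n → Carrier
    F u = f (reflect n z u) * C ((+ toℕ u ℤ.- y) ℤ.* a)

    C′ S′ : Fin n → Carrier
    C′ s = C (+ toℕ s ℤ.* a)
    S′ s = S (+ toℕ s ℤ.* a)

    c c′ : Carrier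
    c  = C ((z ℤ.- y) ℤ.* a)
    c′ = S ((z ℤ.- y) ℤ.* a)

    expand : ∀ s → F (reflect n z s) ≈ c * (f s * C′ s) + c′ * (f s * S′ s)
    expand s = begin
      f (reflect n z (reflect n z s)) * C ((+ toℕ (reflect n z s) ℤ.- y) ℤ.* a)
        ≈⟨ *-cong (reflexive (cong f (reflect-involutive n z s)))
                  (trans (C-cong-∣ ((+ toℕ (reflect n z s) ℤ.- y) ℤ.* a) ((z ℤ.- y) ℤ.* a ℤ.- + toℕ s ℤ.* a) (toℕ-reflect-∣ z y a s))
                         (C-sub ((z ℤ.- y) ℤ.* a) (+ toℕ s ℤ.* a))) ⟩
      f s * (c * C′ s + c′ * S′ s)
        ≈⟨ solve 5 (λ f c d x y → f :* (c :* x :+ d :* y) := c :* (f :* x) :+ d :* (f :* y)) refl (f s) c c′ (C′ s) (S′ s) ⟩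
      c * (f s * C′ s) + c′ * (f s * S′ s)   ∎

  -- Real part of the sum of χ_j(a) over all j: it is n if n divides a, and 0 otherwise.
  T : ℤ → Carrier
  T a = sum {n} (λ j → C (+ toℕ j ℤ.* a))

  ∤⇒T≈0 : ∀ {a} → ¬ (+ n ∣ℤ a) → T a ≈ 0#
  ∤⇒T≈0 {a} n∤a = x≉0∧xy≈0⇒y≈0 {1# - C a} 1-C≉0 (begin
    (1# - C a) * T a      ≈⟨ [y-z]x≈yx-zx (T a) 1# (C a) ⟩
    1# * T a - C a * T a  ≈⟨ +-cong (*-identityˡ (T a)) (-‿cong (sym T≈CT)) ⟩
    T a - T a             ≈⟨ -‿inverseʳ (T a) ⟩
    0#                    ∎)
    where
    1-C≉0 : ¬ (1# - C a ≈ 0#)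
    1-C≉0 1-C≈0 = n∤a (C≈1⇒∣ a (begin
      C a                 ≈⟨ solve 2 (λ x c → c := x :- (x :- c)) refl 1# (C a) ⟩
      1# - (1# - C a)     ≈⟨ +-congˡ (-‿cong 1-C≈0) ⟩
      1# - 0#             ≈⟨ x-0≈x 1# ⟩
      1#                  ∎))

    T≈CT : T a ≈ C a * T a
    T≈CT = begin
      T a ≈⟨ sum-cong {n} (λ j → trans (*-identityˡ _) (reflexive (cong (λ b → C (b ℤ.* a)) (ℤ.+-identityʳ (+ toℕ j))))) ⟨
      -- Convolution with the constant function 1 at z = 1, y = 0 is the shift that multiplies the
      -- character sum by `C a`.
      sum {n} (λ j → 1# * C ((+ toℕ j ℤ.- + 0) ℤ.* a)) ≈⟨ convolution {λ _ → 1#} (λ _ → refl) (+ 1) (+ 0) a ⟩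
      C ((+ 1 ℤ.- + 0) ℤ.* a) * sum {n} (λ j → 1# * C (+ toℕ j ℤ.* a)) ≈⟨ *-cong (reflexive (cong C (ℤ.*-identityˡ a))) (sum-cong {n} (λ j → *-identityˡ _)) ⟩
      C a * T a ∎

  T[0]≉0 : ¬ (T (+ 0) ≈ 0#)
  T[0]≉0 T≈0 = sum-ones≉0 n (trans (sum-cong {n} (λ j → sym (trans (reflexive (cong C (ℤ.*-zeroʳ (+ toℕ j)))) C-0))) T≈0)
    where
    0<sum-ones : ∀ m → 0# < sum {suc m} (λ _ → 1#)
    0<sum-ones zero    = <-respʳ-≈ (sym (+-identityʳ 1#)) 0<1
    0<sum-ones (suc m) = 0<x∧0<y⇒0<x+y 0<1 (0<sum-ones m)

    sum-ones≉0 : ∀ m .{{_ : NonZero m}} → ¬ (sum {m} (λ _ → 1#) ≈ 0#)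
    sum-ones≉0 (suc m) eq = <⇒≉ (0<sum-ones m) (sym eq)

  module _ (w : Fin n → Carrier) where

    -- The χ_j and χ_{-j} components of w at y for a = j, combined so that only cosines occur.
    L : ℤ → Fin n → Carrier
    L a y = sum {n} (λ v → w v * C ((+ toℕ v ℤ.- + toℕ y) ℤ.* a))

    -- Exchanging the two sums leaves `T` of v - y as the coefficient of w v, and it vanishes off
    -- the diagonal.
    inversion : ∀ y → sum {n} (λ j → L (+ toℕ j) y) ≈ w y * T (+ 0)
    inversion y = begin
      sum {n} (λ j → sum {n} (λ v → w v * C ((+ toℕ v ℤ.- + toℕ y) ℤ.* + toℕ j)))   ≈⟨ ∑-comm {n} {n} (λ j v → w v * C ((+ toℕ v ℤ.- + toℕ y) ℤ.* + toℕ j)) ⟩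
      sum {n} (λ v → sum {n} (λ j → w v * C ((+ toℕ v ℤ.- + toℕ y) ℤ.* + toℕ j)))   ≈⟨ sum-cong inner ⟩
      sum {n} (λ v → w v * T (+ toℕ v ℤ.- + toℕ y))                             ≈⟨ sum-single (λ v → w v * T (+ toℕ v ℤ.- + toℕ y)) y off-diagonal ⟩
      w y * T (+ toℕ y ℤ.- + toℕ y)                                         ≡⟨ cong (λ a → w y * T a) (ℤ.+-inverseʳ (+ toℕ y)) ⟩
      w y * T (+ 0)                                                         ∎
      where
      inner : ∀ v → sum {n} (λ j → w v * C ((+ toℕ v ℤ.- + toℕ y) ℤ.* + toℕ j)) ≈ w v * T (+ toℕ v ℤ.- + toℕ y)
      inner v = begin
        sum {n} (λ j → w v * C (d ℤ.* + toℕ j))   ≈⟨ *-distribˡ-sum {n} (w v) (λ j → C (d ℤ.* + toℕ j)) ⟨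
        w v * sum {n} (λ j → C (d ℤ.* + toℕ j))   ≈⟨ *-congˡ (sum-cong {n} (λ j → reflexive (cong C (ℤ.*-comm d (+ toℕ j))))) ⟩
        w v * T d                             ∎
        where d = + toℕ v ℤ.- + toℕ y

      off-diagonal : ∀ v → v ≢ y → w v * T (+ toℕ v ℤ.- + toℕ y) ≈ 0#
      off-diagonal v v≢y = trans (*-congˡ (∤⇒T≈0 (v≢y ∘ toℕ-∣-injective))) (zeroʳ (w v))

  module _ {P : Fin n → Set} (P? : ∀ s → Dec (P s)) (P-neg : ∀ {s} → P s → P (reflect n (+ 0) s)) (¬P0 : ¬ P (residue n (+ 0)))
           (w : Fin n → Carrier) (r : Carrier)
           (magic : ∀ u → sum (λ v → indicator ((v Fin.≟ u) ⊎-dec P? (reflect n (+ toℕ v) u)) * w v) ≈ r) where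

    private
      f : Fin n → Carrier
      f s = indicator (P? s)

      f-sym : Symmetric f
      f-sym s = indicator-⇔ (P? (reflect n (+ 0) s)) (P? s) (λ p → subst P (reflect-involutive n (+ 0) s) (P-neg p)) P-neg

    -- With P the connection set and a = j this is 1 + χ_j(S), an eigenvalue of the closed adjacency
    -- matrix.
    eigenvalue : ℤ → Carrier
    eigenvalue a = 1# + sum (λ s → f s * C (+ toℕ s ℤ.* a))

    private
      -- The closed adjacency matrix. As 0 does not satisfy P, it is the identity plus the matrix of
      -- convolution with `f`.
      D : Fin n → Fin n → Carrier
      D v u = indicator ((v Fin.≟ u) ⊎-dec P? (reflect n (+ toℕ v) u))

      D≈ : ∀ v u → D v u ≈ indicator (v Fin.≟ u) + f (reflect n (+ toℕ v) u)
      D≈ v u = indicator-⊎ (v Fin.≟ u) (P? (reflect n (+ toℕ v) u)) disjoint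
        where
        disjoint : ¬ (v ≡ u × P (reflect n (+ toℕ v) u))
        disjoint (≡.refl , p) = ¬P0 (subst (λ z → P (residue n z)) (ℤ.+-inverseʳ (+ toℕ v)) p)

    -- The double sum of w v · D v u · c u is evaluated in both orders. Summing over u first
    -- produces the eigenvalue, by convolution; summing over v first produces r by the magic
    -- condition, and then the sum of c vanishes because n does not divide a.
    magic⇒eigenvalue*L≈0 : ∀ {a} → ¬ (+ n ∣ℤ a) → ∀ y → eigenvalue a * L w a y ≈ 0#
    magic⇒eigenvalue*L≈0 {a} n∤a y = begin
      eigenvalue a * L w a y                                    ≈⟨ *-distribˡ-sum (eigenvalue a) (λ v → w v * c v) ⟩
      sum {n} (λ v → eigenvalue a * (w v * c v))                ≈⟨ sum-cong (λ v → solve 3 (λ e w c → e :* (w :* c) := w :* (c :* e)) refl (eigenvalue a) (w v) (c v)) ⟩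
      sum {n} (λ v → w v * (c v * eigenvalue a))                ≈⟨ sum-cong (λ v → *-congˡ (row v)) ⟩
      sum {n} (λ v → w v * sum {n} (λ u → D v u * c u))         ≈⟨ sum-cong (λ v → *-distribˡ-sum (w v) (λ u → D v u * c u)) ⟩
      sum {n} (λ v → sum {n} (λ u → w v * (D v u * c u)))       ≈⟨ ∑-comm (λ v u → w v * (D v u * c u)) ⟩
      sum {n} (λ u → sum {n} (λ v → w v * (D v u * c u)))       ≈⟨ sum-cong column ⟩
      sum {n} (λ u → r * c u)                                   ≈⟨ *-distribˡ-sum r c ⟨
      r * sum c                                                 ≈⟨ *-congˡ sum-c≈0 ⟩
      r * 0#                                                    ≈⟨ zeroʳ r ⟩
      0#                                                        ∎
      where
      c : Fin n → Carrier
      c u = C ((+ toℕ u ℤ.- + toℕ y) ℤ.* a)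

      row : ∀ v → c v * eigenvalue a ≈ sum {n} (λ u → D v u * c u)
      row v = begin
        c v * eigenvalue a                                      ≈⟨ distribˡ (c v) 1# _ ⟩
        c v * 1# + c v * sum {n} (λ s → f s * C (+ toℕ s ℤ.* a)) ≈⟨ +-cong diagonal (sym (convolution f-sym (+ toℕ v) (+ toℕ y) a)) ⟩
        sum {n} (λ u → indicator (v Fin.≟ u) * c u) + sum {n} (λ u → f (reflect n (+ toℕ v) u) * c u)
          ≈⟨ ∑-distrib-+ (λ u → indicator (v Fin.≟ u) * c u) (λ u → f (reflect n (+ toℕ v) u) * c u) ⟨
        sum {n} (λ u → indicator (v Fin.≟ u) * c u + f (reflect n (+ toℕ v) u) * c u)
          ≈⟨ sum-cong (λ u → trans (*-congʳ (D≈ v u)) (distribʳ (c u) _ _)) ⟨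
        sum {n} (λ u → D v u * c u)                             ∎
        where
        diagonal : c v * 1# ≈ sum {n} (λ u → indicator (v Fin.≟ u) * c u)
        diagonal = begin
          c v * 1#                        ≈⟨ *-comm (c v) 1# ⟩
          1# * c v                        ≈⟨ *-congʳ (indicator-true (v Fin.≟ v) ≡.refl) ⟨
          indicator (v Fin.≟ v) * c v     ≈⟨ sum-single (λ u → indicator (v Fin.≟ u) * c u) v
                                              (λ u u≢v → trans (*-congʳ (indicator-false (v Fin.≟ u) (u≢v ∘ ≡.sym))) (zeroˡ (c u))) ⟨
          sum {n} (λ u → indicator (v Fin.≟ u) * c u) ∎

      column : ∀ u → sum {n} (λ v → w v * (D v u * c u)) ≈ r * c u
      column u = begin
        sum {n} (λ v → w v * (D v u * c u))   ≈⟨ sum-cong (λ v → solve 3 (λ w d c → w :* (d :* c) := (d :* w) :* c) refl (w v) (D v u) (c u)) ⟩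
        sum {n} (λ v → (D v u * w v) * c u)   ≈⟨ *-distribʳ-sum (c u) (λ v → D v u * w v) ⟨
        sum {n} (λ v → D v u * w v) * c u     ≈⟨ *-congʳ (magic u) ⟩
        r * c u                               ∎

      sum-c≈0 : sum c ≈ 0#
      sum-c≈0 = begin
        sum {n} c                                                       ≈⟨ sum-cong (λ u → *-identityˡ (c u)) ⟨
        sum {n} (λ u → 1# * c u)                                        ≈⟨ convolution {λ _ → 1#} (λ _ → refl) (+ 0) (+ toℕ y) a ⟩
        C ((+ 0 ℤ.- + toℕ y) ℤ.* a) * sum {n} (λ s → 1# * C (+ toℕ s ℤ.* a)) ≈⟨ *-congˡ (trans (sum-cong {n} (λ s → *-identityˡ _)) (∤⇒T≈0 n∤a)) ⟩
        C ((+ 0 ℤ.- + toℕ y) ℤ.* a) * 0#                                ≈⟨ zeroʳ _ ⟩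
        0#                                                              ∎

    magic⇒periodic : ∀ p q → (∀ (j : Fin n) → eigenvalue (+ toℕ j) ≈ 0# → + n ∣ℤ (+ toℕ p ℤ.- + toℕ q) ℤ.* + toℕ j) → w p ≈ w q
    magic⇒periodic p q period = x∙y⁻¹≈ε⇒x≈y (w p) (w q) (x≉0∧xy≈0⇒y≈0 T[0]≉0 (begin
      T (+ 0) * (w p - w q)                   ≈⟨ solve 3 (λ t x y → t :* (x :- y) := x :* t :- y :* t) refl (T (+ 0)) (w p) (w q) ⟩
      w p * T (+ 0) - w q * T (+ 0)           ≈⟨ x≈y⇒x∙y⁻¹≈ε wT≈wT ⟩
      0#                                      ∎))
      where
      L≈L : ∀ j → L w (+ toℕ j) p ≈ L w (+ toℕ j) q
      -- The split is on divisibility, which is decidable, unlike vanishing of the eigenvalue. If n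
      -- divides (p - q) j, the cosines at p and q agree; this includes j = 0. Otherwise the
      -- eigenvalue is nonzero and n does not divide j, so both components vanish.
      L≈L j with + n ∣ℤ? (+ toℕ p ℤ.- + toℕ q) ℤ.* + toℕ j
      ... | yes n∣pj = sum-cong {n} (λ v → *-congˡ {w v} (C-cong-∣ ((+ toℕ v ℤ.- + toℕ p) ℤ.* + toℕ j) ((+ toℕ v ℤ.- + toℕ q) ℤ.* + toℕ j)
                        (∣-resp-≡ (lemma (+ toℕ v) (+ toℕ p) (+ toℕ q) (+ toℕ j)) (∣m⇒∣-m n∣pj))))
        where
        lemma : ∀ v p q j → ℤ.- ((p ℤ.- q) ℤ.* j) ≡ (v ℤ.- p) ℤ.* j ℤ.- (v ℤ.- q) ℤ.* j
        lemma = solve-∀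
      ... | no n∤pj = trans (L≈0 p) (sym (L≈0 q))
        where
        L≈0 : ∀ y → L w (+ toℕ j) y ≈ 0#
        L≈0 y = x≉0∧xy≈0⇒y≈0 (n∤pj ∘ period j) (magic⇒eigenvalue*L≈0 (n∤pj ∘ ∣n⇒∣m*n (+ toℕ p ℤ.- + toℕ q)) y)

      wT≈wT : w p * T (+ 0) ≈ w q * T (+ 0)
      wT≈wT = trans (sym (inversion w p)) (trans (sum-cong L≈L) (inversion w q))

-- The connection set and its integer representatives.

module Connection (n : ℕ) .{{_ : NonZero n}} (c : ℕ) where

  private
    S = connectionSet n c
    S₁ = ⁅ residue n (+ 1) ⁆
    S₂ = ⁅ residue n (ℤ.- + 1) ⁆
    S₃ = ⁅ residue n (+ c) ⁆
    S₄ = ⁅ residue n (ℤ.- + c) ⁆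
    S₅ = ⁅ residue n (+ (n ℕ./ 2)) ⁆

  -- Integer representatives of the connection set, so that negation and size can be treated by
  -- cases on integers instead of residues.
  data Connector : ℤ → Set where
    one      : Connector (+ 1)
    minusOne : Connector (ℤ.- + 1)
    +c       : Connector (+ c)
    -c       : Connector (ℤ.- + c)
    n/2      : Connector (+ (n ℕ./ 2))

  ∈-connectionSet⁻ : ∀ {s} → s ∈ S → ∃[ z ] Connector z × s ≡ residue n z
  ∈-connectionSet⁻ s∈S with x∈p∪q⁻ S₁ (S₂ ∪ S₃ ∪ S₄ ∪ S₅) s∈S
  ... | inj₁ s∈S₁ = + 1 , one , x∈⁅y⁆⇒x≡y _ s∈S₁
  ... | inj₂ s∈S with x∈p∪q⁻ S₂ (S₃ ∪ S₄ ∪ S₅) s∈S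
  ... | inj₁ s∈S₂ = ℤ.- + 1 , minusOne , x∈⁅y⁆⇒x≡y _ s∈S₂
  ... | inj₂ s∈S with x∈p∪q⁻ S₃ (S₄ ∪ S₅) s∈S
  ... | inj₁ s∈S₃ = + c , +c , x∈⁅y⁆⇒x≡y _ s∈S₃
  ... | inj₂ s∈S with x∈p∪q⁻ S₄ S₅ s∈S
  ... | inj₁ s∈S₄ = ℤ.- + c , -c , x∈⁅y⁆⇒x≡y _ s∈S₄
  ... | inj₂ s∈S₅ = + (n ℕ./ 2) , n/2 , x∈⁅y⁆⇒x≡y _ s∈S₅

  ∈-connectionSet⁺ : ∀ {z} → Connector z → residue n z ∈ S
  ∈-connectionSet⁺ one      = x∈p∪q⁺ (inj₁ (x∈⁅x⁆ _))
  ∈-connectionSet⁺ minusOne = x∈p∪q⁺ (inj₂ (x∈p∪q⁺ (inj₁ (x∈⁅x⁆ _))))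
  ∈-connectionSet⁺ +c       = x∈p∪q⁺ (inj₂ (x∈p∪q⁺ (inj₂ (x∈p∪q⁺ (inj₁ (x∈⁅x⁆ _))))))
  ∈-connectionSet⁺ -c       = x∈p∪q⁺ (inj₂ (x∈p∪q⁺ (inj₂ (x∈p∪q⁺ (inj₂ (x∈p∪q⁺ (inj₁ (x∈⁅x⁆ _))))))))
  ∈-connectionSet⁺ n/2      = x∈p∪q⁺ (inj₂ (x∈p∪q⁺ (inj₂ (x∈p∪q⁺ (inj₂ (x∈p∪q⁺ (inj₂ (x∈⁅x⁆ _))))))))

  connectionSet-neg : 2 ℕ.∣ n → ∀ {s} → s ∈ S → reflect n (+ 0) s ∈ S
  connectionSet-neg 2∣n s∈S with ∈-connectionSet⁻ s∈S
  ... | z , z∈ , ≡.refl = subst (_∈ S) (≡.sym reflect≡) (residue-neg∈S z∈)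
    where
    lemma : ∀ r z → ℤ.- (r ℤ.- z) ≡ (+ 0 ℤ.- r) ℤ.- ℤ.- z
    lemma = solve-∀

    reflect≡ : reflect n (+ 0) (residue n z) ≡ residue n (ℤ.- z)
    reflect≡ = residue-cong n (+ 0 ℤ.- + toℕ (residue n z)) (ℤ.- z) (∣-resp-≡ (lemma (+ toℕ (residue n z)) z) (∣m⇒∣-m (residue-∣ n z)))

    residue-neg∈S : ∀ {z} → Connector z → residue n (ℤ.- z) ∈ S
    residue-neg∈S one      = ∈-connectionSet⁺ minusOne
    residue-neg∈S minusOne = ∈-connectionSet⁺ one
    residue-neg∈S +c       = ∈-connectionSet⁺ -c
    residue-neg∈S -c       = subst (λ z → residue n z ∈ S) (≡.sym (ℤ.neg-involutive (+ c))) (∈-connectionSet⁺ +c)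
    -- The element n/2 is its own negative, since n/2 + n/2 = n for even n.
    residue-neg∈S n/2      = subst (_∈ S) (residue-cong n (+ (n ℕ./ 2)) (ℤ.- + (n ℕ./ 2)) (divides (+ 1) eq)) (∈-connectionSet⁺ n/2)
      where
      double : ∀ h → h ℤ.- ℤ.- h ≡ h ℤ.* + 2
      double = solve-∀

      eq : + (n ℕ./ 2) ℤ.- ℤ.- + (n ℕ./ 2) ≡ + 1 ℤ.* + n
      eq = ≡.trans (double (+ (n ℕ./ 2))) (≡.trans (≡.sym (ℤ.pos-* (n ℕ./ 2) 2))
        (≡.trans (cong +_ (ℕ.m/n*n≡m 2∣n)) (≡.sym (ℤ.*-identityˡ (+ n)))))

  -- Every representative has absolute value strictly between 0 and n. This keeps a vertex apart
  -- from its neighbours in the closed neighbourhood sum.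
  0∉connectionSet : 1 ℕ.< c → c ℕ.< n ℕ./ 2 → residue n (+ 0) ∉ S
  0∉connectionSet 1<c c<n/2 0∈S with ∈-connectionSet⁻ 0∈S
  ... | z , z∈ , eq = ℕ.>⇒∤ {{ℕ.>-nonZero (proj₁ (bounds z∈))}} (proj₂ (bounds z∈)) (∣⇒∣ᵤ (∣-resp-≡ (lemma z) (∣m⇒∣-m (residue-injective n (+ 0) z eq))))
    where
    lemma : ∀ z → ℤ.- (+ 0 ℤ.- z) ≡ z
    lemma = solve-∀

    n/2<n : n ℕ./ 2 ℕ.< n
    n/2<n = ℕ.m/n<m n 2 (ℕ.s≤s (ℕ.s≤s ℕ.z≤n))

    c<n : c ℕ.< n
    c<n = ℕ.<-trans c<n/2 n/2<n

    0<c : 0 ℕ.< c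
    0<c = ℕ.<-trans ℕ.z<s 1<c

    bounds : ∀ {z} → Connector z → 0 ℕ.< ℤ.∣ z ∣ × ℤ.∣ z ∣ ℕ.< n
    bounds one      = ℕ.z<s , ℕ.<-trans 1<c c<n
    bounds minusOne = ℕ.z<s , ℕ.<-trans 1<c c<n
    bounds +c       = 0<c , c<n
    bounds -c       = subst (λ m → 0 ℕ.< m × m ℕ.< n) (≡.sym (ℤ.∣-i∣≡∣i∣ (+ c))) (0<c , c<n)
    bounds n/2      = ℕ.<-trans 0<c c<n/2 , n/2<n

-- From a magic labelling to the absence of proper periods.

module MagicSpectrum (ℝ : RealNumbers) (trig : Trigonometry ℝ) (n : ℕ) .{{n≢0 : NonZero n}} where
  open RealNumbers ℝ hiding (zero)
  open Reals ℝ
  open Angles trig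
  open Fourier ℝ trig n renaming (C to cosine; S to sine)
  open Sum semiring
  open import Relation.Binary.Reasoning.Setoid setoid

  -- Stated for any additive h, so that one induction serves the real part and the imaginary part of
  -- χ_j(S) as well as label sums in ℕ. The function k generalises `allFin` to make the induction
  -- pass to the tail.
  filter-sum : ∀ {B : Set} (_⊕_ : B → B → B) (e : B) (h : B → Carrier) →
    (∀ a b → h (a ⊕ b) ≈ h a + h b) → h e ≈ 0# →
    ∀ {A : Set} {P : Pred A _} (P? : Decidable P) (g : A → B) {m} (k : Fin m → A) →
    h (foldr _⊕_ e (map g (filter P? (tabulate k)))) ≈ sum (λ i → indicator (P? (k i)) * h (g (k i)))
  filter-sum _⊕_ e h h-⊕ h-e P? g {zero}  k = h-e
  filter-sum _⊕_ e h h-⊕ h-e P? g {suc m} k with P? (k zero)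
  ... | yes _ = trans (h-⊕ _ _) (+-cong (sym (*-identityˡ _)) (filter-sum _⊕_ e h h-⊕ h-e P? g (k ∘ suc)))
  ... | no  _ = trans (filter-sum _⊕_ e h h-⊕ h-e P? g (k ∘ suc)) (sym (trans (+-congʳ (zeroˡ _)) (+-identityˡ _)))

  fromℕ : ℕ → Carrier
  fromℕ m = fromℚ (+ m ℚ./ 1)

  fromℕ-+ : ∀ a b → fromℕ (a ℕ.+ b) ≈ fromℕ a + fromℕ b
  fromℕ-+ a b = trans (reflexive (cong fromℚ (≡.trans (cong (ℚ._/ 1) (ℤ.pos-+ a b)) (≡.sym (/-+ (+ a) (+ b) 1)))))
    (+-homo (+ a ℚ./ 1) (+ b ℚ./ 1))

  -- Multiplication by π reduces this to injectivity of `α`.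
  fromℕ-injective : ∀ {a b} → fromℕ a ≈ fromℕ b → a ≡ b
  fromℕ-injective {a} {b} eq = ℤ.+-injective (≡.trans (≡.sym (ℤ.*-identityʳ (+ a)))
    (≡.trans (/-cross⁻¹ (+ a) 1 (+ b) 1 (α-injective (*-congʳ eq))) (ℤ.*-identityʳ (+ b))))

  module _ (c : ℕ) (2∣n : 2 ℕ.∣ n) (1<c : 1 ℕ.< c) (c<n/2 : c ℕ.< n ℕ./ 2) where
    open Connection n c

    private
      S = connectionSet n c

    S-eigenvalue : Fin n → Carrier
    S-eigenvalue j = 1# + sum (λ s → indicator (s ∈? S) * cosine (+ toℕ s ℤ.* + toℕ j))

    χ-angle : ∀ (x j : Fin n) → (+ (2 ℕ.* toℕ x ℕ.* toℕ j)) ≡ + 2 ℤ.* (+ toℕ x ℤ.* + toℕ j)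
    χ-angle x j = ≡.trans (cong +_ (ℕ.*-assoc 2 (toℕ x) (toℕ j))) (≡.trans (ℤ.pos-* 2 (toℕ x ℕ.* toℕ j)) (cong (+ 2 ℤ.*_) (ℤ.pos-* (toℕ x) (toℕ j))))

    -- Only the real part carries information: the imaginary part of χ_j(S) is zero for every j, by
    -- symmetry of S.
    eigenvalue≈0⇒J : ∀ j → S-eigenvalue j ≈ 0# → J ℝ trig n S j
    eigenvalue≈0⇒J j Λ≈0 = (begin
      proj₁ (χ[_] ℝ trig j S)
        ≈⟨ filter-sum (_+ℂ_ ℝ trig) (0ℂ ℝ trig) proj₁ (λ _ _ → refl) refl (_∈? S) (χ ℝ trig j) id ⟩
      sum {n} (λ s → indicator (s ∈? S) * proj₁ (χ ℝ trig j s))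
        ≡⟨ sum-cong-≗ {n} (λ s → cong (λ a → indicator (s ∈? S) * Trigonometry.cos trig (α (a ℚ./ n))) (χ-angle s j)) ⟩
      sum {n} (λ s → indicator (s ∈? S) * cosine (+ toℕ s ℤ.* + toℕ j))
        ≈⟨ solve 2 (λ x s → s := (x :+ s) :- x) refl 1# _ ⟩
      S-eigenvalue j - 1#   ≈⟨ +-congʳ Λ≈0 ⟩
      0# - 1#               ≈⟨ +-identityˡ _ ⟩
      - 1#                  ∎) , (begin
      proj₂ (χ[_] ℝ trig j S)
        ≈⟨ filter-sum (_+ℂ_ ℝ trig) (0ℂ ℝ trig) proj₂ (λ _ _ → refl) refl (_∈? S) (χ ℝ trig j) id ⟩
      sum {n} (λ s → indicator (s ∈? S) * proj₂ (χ ℝ trig j s))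
        ≡⟨ sum-cong-≗ {n} (λ s → cong (λ a → indicator (s ∈? S) * Trigonometry.sin trig (α (a ℚ./ n))) (χ-angle s j)) ⟩
      sum {n} (λ s → indicator (s ∈? S) * sine (+ toℕ s ℤ.* + toℕ j))
        ≈⟨ sine-sum≈0 indicator-symmetric (+ toℕ j) ⟩
      0#                    ∎)
      where
      indicator-symmetric : Symmetric (λ s → indicator (s ∈? S))
      indicator-symmetric s = indicator-⇔ (reflect n (+ 0) s ∈? S) (s ∈? S)
        (λ p → subst (_∈ S) (reflect-involutive n (+ 0) s) (connectionSet-neg 2∣n p)) (connectionSet-neg 2∣n)

    -- It is enough to compare the vertices p and 0, whose labels coincide only if n divides p.
    magic⇒aperiodic : ClosedDistanceMagic (Cay n S) → ∀ p → (∀ j → J ℝ trig n S j → + n ∣ℤ p ℤ.* + toℕ j) → + n ∣ℤ p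
    magic⇒aperiodic (ℓ , r , _ , ℓ-sum) p period =
      ∣-resp-≡ (ℤ.+-identityʳ p) (residue-injective n p (+ 0) (Bijection.injective ℓ (Fin.toℕ-injective (ℕ.suc-injective (fromℕ-injective
        (magic⇒periodic (_∈? S) (connectionSet-neg 2∣n) (0∉connectionSet 1<c c<n/2) w (fromℕ r) magic (residue n p) (residue n (+ 0))
          (λ j Λ≈0 → n∣ j (period j (eigenvalue≈0⇒J j Λ≈0)))))))))
      where
      w : Fin n → Carrier
      w v = fromℕ (label ℓ v)

      magic : ∀ u → sum (λ v → indicator ((v Fin.≟ u) ⊎-dec (reflect n (+ toℕ v) u ∈? S)) * w v) ≈ fromℕ r
      -- `reflect n (+ toℕ v) u` unfolds to the residue by which `Cay` decides whether u is adjacent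
      -- to v, so this sum is the closed neighbourhood sum by definition.
      magic u = trans (sym (filter-sum ℕ._+_ 0 fromℕ fromℕ-+ 0#-homo (λ v → (v Fin.≟ u) ⊎-dec (reflect n (+ toℕ v) u ∈? S)) (label ℓ) id))
        (reflexive (cong fromℕ (ℓ-sum u)))

      lemma : ∀ a b p j → (a ℤ.- p) ℤ.* j ℤ.- (b ℤ.- + 0) ℤ.* j ℤ.+ p ℤ.* j ≡ (a ℤ.- b) ℤ.* j
      lemma = solve-∀

      n∣ : ∀ j → + n ∣ℤ p ℤ.* + toℕ j → + n ∣ℤ (+ toℕ (residue n p) ℤ.- + toℕ (residue n (+ 0))) ℤ.* + toℕ j
      n∣ j n∣pj = ∣-resp-≡ (lemma (+ toℕ (residue n p)) (+ toℕ (residue n (+ 0))) p (+ toℕ j))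
        (∣m∣n⇒∣m+n (∣m∣n⇒∣m-n (∣m⇒∣m*n (+ toℕ j) (residue-∣ n p)) (∣m⇒∣m*n (+ toℕ j) (residue-∣ n (+ 0)))) n∣pj)

-- Types 2 and 3⁻ as integer congruences.

unit : Sign → ℤ
unit Sign.+ = + 1
unit Sign.- = -1ℤ

3∤unit : ∀ s → ¬ (+ 3 ∣ℤ unit s)
3∤unit Sign.+ 3∣1 = ℕ.>⇒∤ (ℕ.s≤s (ℕ.s≤s ℕ.z≤n)) (∣⇒∣ᵤ 3∣1)
3∤unit Sign.- 3∣1 = ℕ.>⇒∤ (ℕ.s≤s (ℕ.s≤s ℕ.z≤n)) (∣⇒∣ᵤ 3∣1)

2∤1+2k : ∀ k → ¬ (+ 2 ∣ℤ + 2 ℤ.* k ℤ.+ + 1)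
2∤1+2k k 2∣ = ℕ.>⇒∤ (ℕ.s≤s (ℕ.s≤s ℕ.z≤n)) (∣⇒∣ᵤ (∣m+n∣m⇒∣n 2∣ (∣m⇒∣m*n k (divides (+ 1) ≡.refl))))

module Types (ℝ : RealNumbers) (trig : Trigonometry ℝ) (n : ℕ) .{{n≢0 : NonZero n}} (c : ℕ) where
  open RealNumbers ℝ
  open Trigonometry trig
  open Reals ℝ
  open Angles trig

  -- `thirdTurn s k` is 2π/3 times this integer, which is ±1 modulo 3.
  thirds : Sign → ℤ → ℤ
  thirds s k = unit s ℤ.+ + 3 ℤ.* k

  thirdTurn≈α : ∀ s k → thirdTurn ℝ trig s k ≈ α ((+ 2 ℤ.* thirds s k) ℚ./ 3)
  thirdTurn≈α s k = trans (+-congʳ (signed-α s)) (trans (sym (α-+ ((+ 2 ℤ.* unit s) ℚ./ 3) ((+ 2 ℤ.* k) ℚ./ 1)))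
    (reflexive (cong α (≡.trans (cong ((+ 2 ℤ.* unit s) ℚ./ 3 ℚ.+_) (/-cross (+ 2 ℤ.* k) 1 (+ 6 ℤ.* k) 3 (sixths k)))
      (≡.trans (/-+ (+ 2 ℤ.* unit s) (+ 6 ℤ.* k) 3) (cong (ℚ._/ 3) (factor (unit s) k)))))))
    where
    signed-α : ∀ s → signed ℝ trig s (α (+ 2 ℚ./ 3)) ≈ α ((+ 2 ℤ.* unit s) ℚ./ 3)
    signed-α Sign.+ = refl
    signed-α Sign.- = sym (α-neg (+ 2 ℚ./ 3))

    sixths : ∀ k → (+ 2 ℤ.* k) ℤ.* + 3 ≡ (+ 6 ℤ.* k) ℤ.* + 1
    sixths = solve-∀

    factor : ∀ u k → + 2 ℤ.* u ℤ.+ + 6 ℤ.* k ≡ + 2 ℤ.* (u ℤ.+ + 3 ℤ.* k)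
    factor = solve-∀

  -- By injectivity of `α` the angles agree only if the fractions 2 m / n and 2 (±1 + 3 k) / 3 do;
  -- it remains to clear denominators and cancel 2.
  α≈thirdTurn : ∀ m s k → α (+ (2 ℕ.* m) ℚ./ n) ≈ thirdTurn ℝ trig s k → + 3 ℤ.* + m ≡ thirds s k ℤ.* + n
  α≈thirdTurn m s k eq = ℤ.*-cancelˡ-≡ (+ 2) _ _
    (≡.trans (≡.sym (≡.trans (cong (ℤ._* + 3) (ℤ.pos-* 2 m)) (left (+ m))))
      (≡.trans (/-cross⁻¹ (+ (2 ℕ.* m)) n (+ 2 ℤ.* thirds s k) 3 (α-injective (trans eq (thirdTurn≈α s k)))) (ℤ.*-assoc (+ 2) (thirds s k) (+ n))))
    where
    left : ∀ m → (+ 2 ℤ.* m) ℤ.* + 3 ≡ + 2 ℤ.* (+ 3 ℤ.* m)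
    left = solve-∀

  Type2⇒thirds : ∀ {j} → Type2 ℝ trig n c j →
    (∃[ s ] ∃[ k ] + 3 ℤ.* + toℕ j ≡ thirds s k ℤ.* + n) ×
    (∃[ s ] ∃[ k ] + 3 ℤ.* (+ toℕ j ℤ.* + c) ≡ thirds s k ℤ.* + n)
  Type2⇒thirds {j} (_ , _ , s₁ , s₂ , k₁ , k₂ , angles⊆ , _) =
    third (toℕ j) (angles⊆ (inj₁ refl)) ,
    subst (λ m → ∃[ s ] ∃[ k ] + 3 ℤ.* m ≡ thirds s k ℤ.* + n) (ℤ.pos-* (toℕ j) c)
      (third (toℕ j ℕ.* c) (angles⊆ (inj₂ (reflexive (cong (λ m → α (+ m ℚ./ n)) (≡.sym (ℕ.*-assoc 2 (toℕ j) c)))))))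
    where
    third : ∀ m → pair ℝ trig (thirdTurn ℝ trig s₁ k₁) (thirdTurn ℝ trig s₂ k₂) (α (+ (2 ℕ.* m) ℚ./ n)) →
            ∃[ s ] ∃[ k ] + 3 ℤ.* + m ≡ thirds s k ℤ.* + n
    third m (inj₁ eq) = s₁ , k₁ , α≈thirdTurn m s₁ k₁ eq
    third m (inj₂ eq) = s₂ , k₂ , α≈thirdTurn m s₂ k₂ eq

  Type2⇒∣3j : ∀ {j} → Type2 ℝ trig n c j → + n ∣ℤ + 3 ℤ.* + toℕ j
  Type2⇒∣3j t2 with proj₁ (Type2⇒thirds t2)
  ... | s , k , eq = divides (thirds s k) eq

  -- Multiplying 3 j = t₁ n by c and comparing with 3 j c = t₂ n gives t₁ c = t₂, and t₂ is prime to
  -- 3.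
  Type2⇒3∤c : ∀ {j} → Type2 ℝ trig n c j → ¬ (+ 3 ∣ℤ + c)
  Type2⇒3∤c {j} t2 3∣c with Type2⇒thirds t2
  ... | (s₁ , k₁ , eq₁) , (s₂ , k₂ , eq₂) = 3∤unit s₂ (∣-resp-≡ (cancel (unit s₂) k₂)
    (∣m∣n⇒∣m-n (∣-resp-≡ thirds≡ (∣n⇒∣m*n (thirds s₁ k₁) 3∣c)) (∣m⇒∣m*n k₂ (divides (+ 1) ≡.refl))))
    where
    cancel : ∀ u k → (u ℤ.+ + 3 ℤ.* k) ℤ.- + 3 ℤ.* k ≡ u
    cancel = solve-∀

    rearrange : ∀ t c n → t ℤ.* c ℤ.* n ≡ t ℤ.* n ℤ.* c
    rearrange = solve-∀

    thirds≡ : thirds s₁ k₁ ℤ.* + c ≡ thirds s₂ k₂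
    thirds≡ = ℤ.*-cancelʳ-≡ _ _ (+ n) (≡.trans (rearrange (thirds s₁ k₁) (+ c) (+ n))
      (≡.trans (cong (ℤ._* + c) (≡.sym eq₁)) (≡.trans (ℤ.*-assoc (+ 3) (+ toℕ j) (+ c)) eq₂)))

-- Splitting off the power of two from an integer prime to 3.

-- For d ≡ σ (mod 3) the sign is forced by 2 ≡ -1 (mod 3).
TwoPower×SixK±1 : ℤ → ℕ → Set
TwoPower×SixK±1 σ d = ∃[ s ] ∃[ k ] + d ≡ (+ 2) ℤ.^ s ℤ.* (+ 6 ℤ.* + k ℤ.+ σ ℤ.* -1ℤ ℤ.^ s)

-- Doubling negates the residue modulo 3 and also the power of -1, so the bracket is unchanged.
double : ∀ σ d → TwoPower×SixK±1 σ d → TwoPower×SixK±1 (ℤ.- σ) (2 ℕ.* d)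
double σ d (s , k , eq) = suc s , k ,
  ≡.trans (ℤ.pos-* 2 d) (≡.trans (cong (+ 2 ℤ.*_) eq) (lemma ((+ 2) ℤ.^ s) (+ k) σ (-1ℤ ℤ.^ s)))
  where
  lemma : ∀ t k σ e → + 2 ℤ.* (t ℤ.* (+ 6 ℤ.* k ℤ.+ σ ℤ.* e)) ≡ (+ 2 ℤ.* t) ℤ.* (+ 6 ℤ.* k ℤ.+ (ℤ.- σ) ℤ.* (-1ℤ ℤ.* e))
  lemma = solve-∀

data Parity : ℕ → Set where
  even : ∀ i → Parity (2 ℕ.* i)
  odd  : ∀ i → Parity (1 ℕ.+ 2 ℕ.* i)

parity : ∀ m → Parity m
parity zero = even 0
parity (suc m) with parity m
... | even i = odd i
... | odd i  = subst Parity (ℕ.*-suc 2 i) (even (suc i))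

-- Halving exchanges the classes 1 and 2 modulo 3, so the induction must carry both.
ByResidueModulo3 : ℕ → Set
ByResidueModulo3 d =
  (∀ m → d ≡ 1 ℕ.+ 3 ℕ.* m → TwoPower×SixK±1 (+ 1) d) ×
  (∀ m → d ≡ 2 ℕ.+ 3 ℕ.* m → TwoPower×SixK±1 -1ℤ d)

twoPower×sixK±1 : ∀ d → ByResidueModulo3 d
twoPower×sixK±1 = <-rec _ step
  where
  step : ∀ d → (∀ {e} → e ℕ.< d → ByResidueModulo3 e) → ByResidueModulo3 d
  step d rec = one , two
    where
    -- Writing the half as a successor supplies the positivity that makes it strictly smaller than
    -- d.
    halve : ∀ {e} → d ≡ 2 ℕ.* suc e → suc e ℕ.< d
    halve {e} ≡.refl = ℕ.m<m+n (suc e) ℕ.z<s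

    one : ∀ m → d ≡ 1 ℕ.+ 3 ℕ.* m → TwoPower×SixK±1 (+ 1) d
    one m d≡ with parity m
    ... | even i = 0 , i , ≡.trans (cong +_ d≡) (≡.trans (cong (λ x → + 1 ℤ.+ x) (≡.trans (ℤ.pos-* 3 (2 ℕ.* i)) (cong (+ 3 ℤ.*_) (ℤ.pos-* 2 i)))) (lemma (+ i)))
      where
      lemma : ∀ i → + 1 ℤ.+ + 3 ℤ.* (+ 2 ℤ.* i) ≡ + 1 ℤ.* (+ 6 ℤ.* i ℤ.+ + 1 ℤ.* + 1)
      lemma = solve-∀
    ... | odd i = subst (TwoPower×SixK±1 (+ 1)) (≡.sym d≡2e) (double -1ℤ _ (proj₂ (rec (halve d≡2e)) i ≡.refl))
      where
      d≡2e : d ≡ 2 ℕ.* (2 ℕ.+ 3 ℕ.* i)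
      d≡2e = ≡.trans d≡ (lemma i)
        where
        lemma : ∀ i → 1 ℕ.+ 3 ℕ.* (1 ℕ.+ 2 ℕ.* i) ≡ 2 ℕ.* (2 ℕ.+ 3 ℕ.* i)
        lemma = ℕ-Solver.solve-∀

    two : ∀ m → d ≡ 2 ℕ.+ 3 ℕ.* m → TwoPower×SixK±1 -1ℤ d
    two m d≡ with parity m
    ... | even i = subst (TwoPower×SixK±1 -1ℤ) (≡.sym d≡2e) (double (+ 1) _ (proj₁ (rec (halve d≡2e)) i ≡.refl))
      where
      d≡2e : d ≡ 2 ℕ.* (1 ℕ.+ 3 ℕ.* i)
      d≡2e = ≡.trans d≡ (lemma i)
        where
        lemma : ∀ i → 2 ℕ.+ 3 ℕ.* (2 ℕ.* i) ≡ 2 ℕ.* (1 ℕ.+ 3 ℕ.* i)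
        lemma = ℕ-Solver.solve-∀
    -- Here d = 5 + 6 i = 6 (i + 1) - 1, whence the witness `suc i`.
    ... | odd i = 0 , suc i , ≡.trans (cong +_ d≡) (≡.trans (cong (λ x → + 2 ℤ.+ x) (≡.trans (ℤ.pos-* 3 (1 ℕ.+ 2 ℕ.* i)) (cong (λ x → + 3 ℤ.* (+ 1 ℤ.+ x)) (ℤ.pos-* 2 i)))) (lemma (+ i)))
      where
      lemma : ∀ i → + 2 ℤ.+ + 3 ℤ.* (+ 1 ℤ.+ + 2 ℤ.* i) ≡ + 1 ℤ.* (+ 6 ℤ.* (+ 1 ℤ.+ i) ℤ.+ -1ℤ ℤ.* + 1)
      lemma = solve-∀

-- Determination of n and d by elementary number theory.

open import Data.Nat.Base using (_≤_; _<_; _∸_; _/_)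
open import Data.Nat.Divisibility using (_∣_)

-- What remains of types 2 and 3⁻ for c = d + 1.
TypeCongruence : ℕ → ℕ → ℕ → Set
TypeCongruence n d j = (+ n ∣ℤ + 3 ℤ.* + j) ⊎ (∃[ k ] + j ℤ.* (+ 2 ℤ.* + d) ≡ + n ℤ.* (+ 2 ℤ.* k ℤ.+ + 1))

-- The labelling and the characters enter only through `aperiodic`. Its premise runs over all
-- natural j satisfying the congruences, a range that contains 𝒥ₙ(S).
module Arithmetic (n d : ℕ) (6≤n : 6 ≤ n) (0<d : 0 < d) (2d<n : 2 ℕ.* d < n)
  (aperiodic : ∀ p → (∀ j → TypeCongruence n d j → + n ∣ℤ p ℤ.* + j) → + n ∣ℤ p) where

  n∣6d : n ∣ 6 ℕ.* d
  n∣6d = ∣⇒∣ᵤ (∣-resp-≡ (≡.sym (ℤ.pos-* 6 d)) (aperiodic (+ 6 ℤ.* + d) period))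
    where
    three : ∀ d j → (+ 2 ℤ.* d) ℤ.* (+ 3 ℤ.* j) ≡ + 6 ℤ.* d ℤ.* j
    three = solve-∀

    six : ∀ d j → + 3 ℤ.* (j ℤ.* (+ 2 ℤ.* d)) ≡ + 6 ℤ.* d ℤ.* j
    six = solve-∀

    period : ∀ j → TypeCongruence n d j → + n ∣ℤ + 6 ℤ.* + d ℤ.* + j
    period j (inj₁ n∣3j) = ∣-resp-≡ (three (+ d) (+ j)) (∣n⇒∣m*n (+ 2 ℤ.* + d) n∣3j)
    period j (inj₂ (k , eq)) = ∣-resp-≡ (six (+ d) (+ j)) (∣n⇒∣m*n (+ 3) (divides (+ 2 ℤ.* k ℤ.+ + 1) (≡.trans eq (ℤ.*-comm (+ n) _))))

  n≢3d : n ≢ 3 ℕ.* d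
  n≢3d n≡3d = ℕ.>⇒∤ (ℕ.<-≤-trans (s≤s (s≤s (s≤s (s≤s z≤n)))) 6≤n) (∣⇒∣ᵤ (aperiodic (+ 3) period))
    where
    instance
      d≢0 : NonZero d
      d≢0 = ℕ.>-nonZero 0<d

    -- For n = 3 d, cancelling d gives 2 j = 3 (2 k + 1) = 6 k + 3; subtracting 6 k + 2 exhibits 1
    -- as an even number.
    odd≡even : ∀ j k → + j ℤ.* (+ 2 ℤ.* + d) ≡ + n ℤ.* (+ 2 ℤ.* k ℤ.+ + 1) → + 2 ℤ.* (+ j ℤ.- + 3 ℤ.* k ℤ.- + 1) ≡ + 1
    odd≡even j k eq = ≡.trans (expand (+ j) k) (≡.trans (cong (ℤ._- (+ 6 ℤ.* k ℤ.+ + 2)) 2j≡) (collapse k))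
      where
      rearrange : ∀ j d → j ℤ.* (+ 2 ℤ.* d) ≡ (+ 2 ℤ.* j) ℤ.* d
      rearrange = solve-∀
      rearrange′ : ∀ k d → (+ 3 ℤ.* d) ℤ.* (+ 2 ℤ.* k ℤ.+ + 1) ≡ (+ 3 ℤ.* (+ 2 ℤ.* k ℤ.+ + 1)) ℤ.* d
      rearrange′ = solve-∀
      expand : ∀ j k → + 2 ℤ.* (j ℤ.- + 3 ℤ.* k ℤ.- + 1) ≡ + 2 ℤ.* j ℤ.- (+ 6 ℤ.* k ℤ.+ + 2)
      expand = solve-∀
      collapse : ∀ k → + 3 ℤ.* (+ 2 ℤ.* k ℤ.+ + 1) ℤ.- (+ 6 ℤ.* k ℤ.+ + 2) ≡ + 1
      collapse = solve-∀

      2j≡ : + 2 ℤ.* + j ≡ + 3 ℤ.* (+ 2 ℤ.* k ℤ.+ + 1)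
      2j≡ = ℤ.*-cancelʳ-≡ _ _ (+ d) (≡.trans (≡.sym (rearrange (+ j) (+ d))) (≡.trans eq
        (≡.trans (cong (ℤ._* (+ 2 ℤ.* k ℤ.+ + 1)) (≡.trans (cong +_ n≡3d) (ℤ.pos-* 3 d))) (rearrange′ k (+ d)))))

    period : ∀ j → TypeCongruence n d j → + n ∣ℤ + 3 ℤ.* + j
    period j (inj₁ n∣3j) = n∣3j
    period j (inj₂ (k , eq)) = contradiction (∣⇒∣ᵤ (divides {+ 2} x (≡.trans (≡.sym (odd≡even j k eq)) (ℤ.*-comm (+ 2) x))))
      (ℕ.>⇒∤ (s≤s (s≤s z≤n)))
      where x = + j ℤ.- + 3 ℤ.* k ℤ.- + 1

  -- Write 6 d = q n. Positivity of d excludes q = 0, `n≢3d` excludes q = 2, and 6 d = 3 (2 d) < 3 n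
  -- excludes q ≥ 3.
  n≡6d : n ≡ 6 ℕ.* d
  n≡6d with n∣6d
  ... | ℕ.divides zero eq = contradiction (ℕ.m*n≡0⇒m≡0∨n≡0 6 eq) λ { (inj₂ d≡0) → ℕ.<⇒≢ 0<d (≡.sym d≡0) }
  ... | ℕ.divides 1 eq = ≡.sym (≡.trans eq (ℕ.*-identityˡ n))
  ... | ℕ.divides 2 eq = contradiction (ℕ.*-cancelˡ-≡ n (3 ℕ.* d) 2 (≡.trans (≡.sym eq) (ℕ.*-assoc 2 3 d))) n≢3d
  ... | ℕ.divides (suc (suc (suc q))) eq = contradiction (ℕ.≤-reflexive (≡.sym eq)) (ℕ.<⇒≱ (begin-strict
    6 ℕ.* d                ≡⟨ ℕ.*-assoc 3 2 d ⟩
    3 ℕ.* (2 ℕ.* d)        <⟨ ℕ.*-monoʳ-< 3 2d<n ⟩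
    3 ℕ.* n                ≤⟨ ℕ.*-monoˡ-≤ n (ℕ.m≤m+n 3 q) ⟩
    (3 ℕ.+ q) ℕ.* n        ∎))
    where open ℕ.≤-Reasoning

  -- If d = 3 e, then 2 d j = 2 e (3 j) is a multiple of n for type 2, while for type 3⁻ the number
  -- 2 d j always is. Hence n would divide 2 d, although 0 < 2 d < n.
  3∤d : ¬ (3 ∣ d)
  3∤d (ℕ.divides e d≡) = ℕ.>⇒∤ {{ℕ.m*n≢0 2 d}} 2d<n (∣⇒∣ᵤ (∣-resp-≡ (≡.sym (ℤ.pos-* 2 d)) (aperiodic (+ 2 ℤ.* + d) period)))
    where
    instance
      d≢0 : NonZero d
      d≢0 = ℕ.>-nonZero 0<d

    +d≡ : + d ≡ + e ℤ.* + 3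
    +d≡ = ≡.trans (cong +_ d≡) (ℤ.pos-* e 3)

    period : ∀ j → TypeCongruence n d j → + n ∣ℤ + 2 ℤ.* + d ℤ.* + j
    period j (inj₁ n∣3j) = ∣-resp-≡ (≡.trans (lemma (+ e) (+ j)) (cong (λ x → + 2 ℤ.* x ℤ.* + j) (≡.sym +d≡))) (∣n⇒∣m*n (+ 2 ℤ.* + e) n∣3j)
      where
      lemma : ∀ e j → + 2 ℤ.* e ℤ.* (+ 3 ℤ.* j) ≡ + 2 ℤ.* (e ℤ.* + 3) ℤ.* j
      lemma = solve-∀
    period j (inj₂ (k , eq)) = divides (+ 2 ℤ.* k ℤ.+ + 1) (≡.trans (ℤ.*-comm (+ 2 ℤ.* + d) (+ j)) (≡.trans eq (ℤ.*-comm (+ n) _)))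

  -- Residue 0 is excluded by `3∤d`, and residue 2 would make c = d + 1 divisible by 3.
  d≡1mod3 : ¬ (3 ∣ suc d) → ∃[ m ] d ≡ 1 ℕ.+ 3 ℕ.* m
  d≡1mod3 3∤1+d with d ℕ.% 3 in r | ℕ.m≡m%n+[m/n]*n d 3 | ℕ.m%n<n d 3
  ... | 0 | eq | _ = contradiction (ℕ.divides (d / 3) eq) 3∤d
  ... | 1 | eq | _ = d / 3 , ≡.trans eq (cong suc (ℕ.*-comm (d / 3) 3))
  ... | 2 | eq | _ = contradiction (ℕ.divides (suc (d / 3)) (cong suc eq)) 3∤1+d
  ... | suc (suc (suc _)) | _ | s≤s (s≤s (s≤s ()))

  2∤1+d⇒2∣d : ¬ (2 ∣ suc d) → 2 ∣ d
  2∤1+d⇒2∣d 2∤1+d with parity d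
  ... | even i = ℕ.divides i (ℕ.*-comm 2 i)
  ... | odd i  = contradiction (ℕ.divides (suc i) (cong (2 ℕ.+_) (ℕ.*-comm 2 i))) 2∤1+d

  parameters : ¬ (2 ∣ suc d) → ¬ (3 ∣ suc d) → Σ[ t ∈ ℕ ] Σ[ k ∈ ℕ ] (2 ≤ t) ×
    (+ n ≡ (+ 3 ℤ.* ((+ 2) ℤ.^ t)) ℤ.* (+ 6 ℤ.* + k ℤ.- -1ℤ ℤ.^ t)) ×
    (+ suc d ≡ ((+ 2) ℤ.^ (t ∸ 1)) ℤ.* (+ 6 ℤ.* + k ℤ.- -1ℤ ℤ.^ t) ℤ.+ + 1) ×
    (2 ≤ suc d)
  parameters 2∤1+d 3∤1+d with d≡1mod3 3∤1+d
  ... | m , d≡ with proj₁ (twoPower×sixK±1 d) m d≡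
  -- Exponent 0 would give d = 6 k + 1, which is odd.
  ... | zero  , k , eq = contradiction (∣-resp-≡ (≡.trans eq (lemma (+ k))) (∣ᵤ⇒∣ (2∤1+d⇒2∣d 2∤1+d))) (2∤1+2k (+ 3 ℤ.* + k))
    where
    lemma : ∀ k → + 1 ℤ.* (+ 6 ℤ.* k ℤ.+ + 1 ℤ.* + 1) ≡ + 2 ℤ.* (+ 3 ℤ.* k) ℤ.+ + 1
    lemma = solve-∀
  -- The exponent of 2 in d is t - 1, so t is one more than `suc s`; the sign then agrees because
  -- (-1)^(t-1) = -(-1)^t.
  ... | suc s , k , eq = suc (suc s) , k , s≤s (s≤s z≤n) ,
    ≡.trans (cong +_ n≡6d) (≡.trans (ℤ.pos-* 6 d) (≡.trans (cong (+ 6 ℤ.*_) eq) (order ((+ 2) ℤ.^ suc s) (+ k) (-1ℤ ℤ.^ suc s)))) ,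
    ≡.trans (cong (λ x → + 1 ℤ.+ x) eq) (connector ((+ 2) ℤ.^ suc s) (+ k) (-1ℤ ℤ.^ suc s)) ,
    s≤s 0<d
    where
    order : ∀ t k e → + 6 ℤ.* (t ℤ.* (+ 6 ℤ.* k ℤ.+ + 1 ℤ.* e)) ≡ (+ 3 ℤ.* (+ 2 ℤ.* t)) ℤ.* (+ 6 ℤ.* k ℤ.- -1ℤ ℤ.* e)
    order = solve-∀

    connector : ∀ t k e → + 1 ℤ.+ t ℤ.* (+ 6 ℤ.* k ℤ.+ + 1 ℤ.* e) ≡ t ℤ.* (+ 6 ℤ.* k ℤ.- -1ℤ ℤ.* e) ℤ.+ + 1
    connector = solve-∀

proposition4p11 : (ℝ : RealNumbers) (trig : Trigonometry ℝ) →
    (n : ℕ) .{{_ : NonZero n}} → 6 ≤ n → 2 ∣ n →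
    (c : ℕ) → 1 < c → c < n / 2 →
    ClosedDistanceMagic (Cay n (connectionSet n c)) →
    (∃[ j ] Type2 ℝ trig n c j) →
    ¬ (2 ∣ c) →
    (∀ j → J ℝ trig n (connectionSet n c) j → Type2 ℝ trig n c j ⊎ Type3⁻ ℝ trig n c j) →
    Σ[ c′ ∈ ℕ ] (1 < c′) × (c′ < n / 2) ×
    (Cay n (connectionSet n c) ≅ Cay n (connectionSet n c′)) ×
    (Σ[ t ∈ ℕ ] Σ[ k ∈ ℕ ] (2 ≤ t) ×
    (+ n ≡ (+ 3 ℤ.* ((+ 2) ℤ.^ t)) ℤ.* (+ 6 ℤ.* + k ℤ.- -1ℤ ℤ.^ t)) ×
    (+ c′ ≡ ((+ 2) ℤ.^ (t ∸ 1)) ℤ.* (+ 6 ℤ.* + k ℤ.- -1ℤ ℤ.^ t) ℤ.+ + 1) ×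
    (2 ≤ c′))
proposition4p11 ℝ trig n 6≤n 2∣n (suc d) 1<c c<n/2 magic (j₀ , type2) 2∤c types =
  suc d , 1<c , c<n/2 , (⤖-id _ , λ u v → ⇔-id _) , parameters 2∤c (Type2⇒3∤c {j₀} type2 ∘ ∣ᵤ⇒∣)
  where
  open Types ℝ trig n (suc d)

  0<d : 0 < d
  0<d = ℕ.s<s⁻¹ 1<c

  2d<n : 2 ℕ.* d < n
  2d<n = ℕ.<-≤-trans (ℕ.*-monoʳ-< 2 (ℕ.<-trans (ℕ.n<1+n d) c<n/2)) (ℕ.≤-reflexive (ℕ.m*[n/m]≡n 2∣n))

  congruence : ∀ j → J ℝ trig n (connectionSet n (suc d)) j → TypeCongruence n d (toℕ j)
  -- With c written as `suc d`, the difference `+ c ℤ.- + 1` computes to `+ d`, so the equation of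
  -- type 3⁻ is already the right alternative of `TypeCongruence`.
  congruence j = [ inj₁ ∘ Type2⇒∣3j {j} , inj₂ ∘ proj₂ ∘ proj₂ ]′ ∘ types j

  open Arithmetic n d 6≤n 0<d 2d<n (λ p period →
    MagicSpectrum.magic⇒aperiodic ℝ trig n (suc d) 2∣n 1<c c<n/2 magic p (λ j j∈J → period (toℕ j) (congruence j j∈J)))
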